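{- Let $a,b,q\in\mathbb{C}$ with $|q|<1$, $b\neq 0$, and $a^2q^{m}\ne b$ for every integer $m\ge 1$. Then $$\sum_{r=0}^{\infty} \frac{(1+aq^{r})(a^2;q)_{r}(b;q)_{r}\left(-a/b\right)^r q^{r(r+1)/2}}{(a^2q/b;q)_{r}(q;q)_{r}} = \frac{(-a;q)_{\infty}(a^2q;q^2)_{\infty}(aq/b;q)_{\infty}}{(a^2q/b;q)_{\infty}}.$$
   Context: For $|q|<1$, $x\in\mathbb{C}$ and an integer $n\ge 0$: $(x;q)_n=\prod_{j=0}^{n-1}(1-xq^j)$ (so $(x;q)_0=1$) and $(x;q)_\infty=\prod_{j=0}^{\infty}(1-xq^j)$. The same notation is used with base $q^2$ in place of $q$. -}

module Defs where

open import Level using (Level; _⊔_) renaming (suc to lsuc)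
open import Algebra.Bundles using (AbelianGroup; CommutativeRing; Semiring)
open import Algebra.Apartness.Bundles using (HeytingCommutativeRing; HeytingField)
open import Algebra.Definitions using (Invertible)
open import Algebra.Structures using (IsCommutativeRing)
import Algebra.Apartness.Properties.HeytingCommutativeRing as HeytingProperties
import Algebra.Construct.DirectProduct as DirectProduct
import Algebra.Definitions.RawMonoid as RawMonoidDefinitions
import Algebra.Definitions.RawSemiring as RawSemiringDefinitions
import Algebra.Properties.AbelianGroup as AbelianGroupProperties
import Algebra.Properties.Ring as RingProperties
import Algebra.Solver.Ring.NaturalCoefficients.Default as SemiringSolver
open import Data.Fin.Base using (toℕ)
open import Data.Nat.Base as ℕ using (ℕ)
open import Data.Product.Base using (_×_; _,_; proj₁; proj₂; ∃; ∃-syntax)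
open import Data.Sum.Base using (_⊎_; inj₁; inj₂; [_,_]′)
import Data.Sum.Base as Sum
open import Function.Base using (_∘_)
open import Relation.Binary.Core using (Rel)
open import Relation.Binary.Structures using (IsStrictPartialOrder)
import Relation.Binary.Reasoning.Setoid as SetoidReasoning

private variable
  c ℓ₁ ℓ₂ : Level

-- The real numbers, axiomatised as a Cauchy-complete Archimedean ordered field.
-- The axioms hold for the classical reals, where x # y means that x and y are
-- distinct and which they determine up to isomorphism, and also for
-- constructive reals, where x # y is the usual positive form of inequality.

record RealField c ℓ₁ ℓ₂ : Set (lsuc (c ⊔ ℓ₁ ⊔ ℓ₂)) where
  infix 4 _<_
  field
    heytingField : HeytingField c ℓ₁ ℓ₂

  open HeytingField heytingField public
  open RawMonoidDefinitions (CommutativeRing.+-rawMonoid (HeytingCommutativeRing.commutativeRing heytingCommutativeRing))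
    using () renaming (_×_ to _·_)

  field
    _<_                  : Rel Carrier ℓ₂
    isStrictPartialOrder : IsStrictPartialOrder _≈_ _<_
    #⇒<⊎>                : ∀ {x y} → x # y → x < y ⊎ y < x
    <⇒#                  : ∀ {x y} → x < y → x # y
    +-monoʳ-<            : ∀ z {x y} → x < y → z + x < z + y
    *-positive           : ∀ {x y} → 0# < x → 0# < y → 0# < x * y
    archimedean          : ∀ x → ∃[ n ] x < n · 1#

  -- Since m and n are interchangeable, this bounds the distance of s m and s n.
  IsCauchy : (ℕ → Carrier) → Set (c ⊔ ℓ₂)
  IsCauchy s = ∀ ε → 0# < ε → ∃[ N ] ∀ m n → N ℕ.≤ m → N ℕ.≤ n → s m < s n + ε

  IsLimit : (ℕ → Carrier) → Carrier → Set (c ⊔ ℓ₂)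
  IsLimit s l = ∀ ε → 0# < ε → ∃[ N ] ∀ n → N ℕ.≤ n → s n < l + ε × l < s n + ε

  field
    complete : ∀ s → IsCauchy s → ∃ (IsLimit s)

  open IsStrictPartialOrder isStrictPartialOrder public
    using (<-resp-≈; <-respˡ-≈; <-respʳ-≈)
    renaming (irrefl to <-irrefl; trans to <-trans)

module HeytingFieldOperations (F : HeytingField c ℓ₁ ℓ₂) where
  open HeytingField F
  private
    R : CommutativeRing c ℓ₁
    R = HeytingCommutativeRing.commutativeRing heytingCommutativeRing

  open RawSemiringDefinitions (Semiring.rawSemiring (CommutativeRing.semiring R)) public
    using (_^_; sum; product)

  -- #⇒invertible returns an inverse of y - 0#.
  infixl 7 _÷_[_]
  _÷_[_] : ∀ x y → y # 0# → Carrier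
  x ÷ y [ y#0 ] = x * proj₁ (#⇒invertible y#0)

  -- The finite q-shifted factorial (x;q)ₙ.
  infix 9 [_⨟_]_
  [_⨟_]_ : Carrier → Carrier → ℕ → Carrier
  [ x ⨟ q ] n = product {n} λ j → 1# - x * q ^ toℕ j

  partialSum : (ℕ → Carrier) → ℕ → Carrier
  partialSum t n = sum {n} λ r → t (toℕ r)

module Complex (ℝ : RealField c ℓ₁ ℓ₂) where
  private
    module ℝ where
      open RealField ℝ public
      open HeytingProperties heytingCommutativeRing public
      open CommutativeRing (HeytingCommutativeRing.commutativeRing heytingCommutativeRing) public
        using (ring; +-abelianGroup; commutativeSemiring)
      open RingProperties ring public
        using (-‿distribˡ-*; -‿distribʳ-*; -1*x≈-x; -‿involutive; ⁻¹-anti-homo-//)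
      open AbelianGroupProperties +-abelianGroup public using (xyx⁻¹≈y)

    ℝ²⁺ = DirectProduct.abelianGroup ℝ.+-abelianGroup ℝ.+-abelianGroup

  open ℝ using (Carrier; _≈_; _#_; _+_; _-_; _*_; -_; 0#; 1#; _<_)

  ℂ : Set c
  ℂ = Carrier × Carrier

  private
    _≈ᶜ_ : Rel ℂ ℓ₁
    _≈ᶜ_ = AbelianGroup._≈_ ℝ²⁺

    _+ᶜ_ _*ᶜ_ : ℂ → ℂ → ℂ
    _+ᶜ_ = AbelianGroup._∙_ ℝ²⁺
    (x , y) *ᶜ (u , v) = x * u - y * v , x * v + y * u

    -ᶜ_ : ℂ → ℂ
    -ᶜ_ = AbelianGroup._⁻¹ ℝ²⁺

    0ᶜ 1ᶜ : ℂ
    0ᶜ = 0# , 0#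
    1ᶜ = 1# , 0#

    _#ᶜ_ : Rel ℂ ℓ₂
    (x , y) #ᶜ (u , v) = x # u ⊎ y # v

  normSq : ℂ → Carrier
  normSq (x , y) = x * x + y * y

  private
    open SetoidReasoning ℝ.setoid
    open SemiringSolver ℝ.commutativeSemiring using (solve; _:+_; _:*_; _:=_)

    -- Differences are written with ν = -1 so that the semiring solver applies.
    ν : Carrier
    ν = - 1#

    sub : ∀ x y → x - y ≈ x + ν * y
    sub x y = ℝ.+-congˡ (ℝ.sym (ℝ.-1*x≈-x y))

    *ᶜ-cong : ∀ {z z′ w w′} → z ≈ᶜ z′ → w ≈ᶜ w′ → (z *ᶜ w) ≈ᶜ (z′ *ᶜ w′)
    *ᶜ-cong (p , q) (r , s) =
      ℝ.+-cong (ℝ.*-cong p r) (ℝ.-‿cong (ℝ.*-cong q s)) ,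
      ℝ.+-cong (ℝ.*-cong p s) (ℝ.*-cong q r)

    *ᶜ-comm : ∀ z w → (z *ᶜ w) ≈ᶜ (w *ᶜ z)
    *ᶜ-comm (x , y) (u , v) =
      ℝ.+-cong (ℝ.*-comm x u) (ℝ.-‿cong (ℝ.*-comm y v)) ,
      solve 4 (λ x y u v → x :* v :+ y :* u := u :* y :+ v :* x) ℝ.refl x y u v

    *ᶜ-assoc : ∀ z w t → ((z *ᶜ w) *ᶜ t) ≈ᶜ (z *ᶜ (w *ᶜ t))
    *ᶜ-assoc (x , y) (u , v) (s , t) = (begin
      (x * u - y * v) * s - (x * v + y * u) * t
        ≈⟨ ℝ.trans (sub _ _) (ℝ.+-congʳ (ℝ.*-congʳ (sub _ _))) ⟩
      (x * u + ν * (y * v)) * s + ν * ((x * v + y * u) * t)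
        ≈⟨ solve 7 (λ ν x y u v s t →
             (x :* u :+ ν :* (y :* v)) :* s :+ ν :* ((x :* v :+ y :* u) :* t) :=
             x :* (u :* s :+ ν :* (v :* t)) :+ ν :* (y :* (u :* t :+ v :* s)))
             ℝ.refl ν x y u v s t ⟩
      x * (u * s + ν * (v * t)) + ν * (y * (u * t + v * s))
        ≈⟨ ℝ.trans (sub _ _) (ℝ.+-congʳ (ℝ.*-congˡ (sub _ _))) ⟨
      x * (u * s - v * t) - y * (u * t + v * s) ∎) , (begin
      (x * u - y * v) * t + (x * v + y * u) * s
        ≈⟨ ℝ.+-congʳ (ℝ.*-congʳ (sub _ _)) ⟩
      (x * u + ν * (y * v)) * t + (x * v + y * u) * s
        ≈⟨ solve 7 (λ ν x y u v s t →
             (x :* u :+ ν :* (y :* v)) :* t :+ (x :* v :+ y :* u) :* s :=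
             x :* (u :* t :+ v :* s) :+ y :* (u :* s :+ ν :* (v :* t)))
             ℝ.refl ν x y u v s t ⟩
      x * (u * t + v * s) + y * (u * s + ν * (v * t))
        ≈⟨ ℝ.+-congˡ (ℝ.*-congˡ (sub _ _)) ⟨
      x * (u * t + v * s) + y * (u * s - v * t) ∎)

    *ᶜ-identityʳ : ∀ z → (z *ᶜ 1ᶜ) ≈ᶜ z
    *ᶜ-identityʳ (x , y) =
      (begin
        x * 1# - y * 0#  ≈⟨ ℝ.+-cong (ℝ.*-identityʳ x) (ℝ.-‿cong (ℝ.zeroʳ y)) ⟩
        x - 0#           ≈⟨ ℝ.x-0≈x x ⟩
        x                ∎) ,
      ℝ.trans (ℝ.+-cong (ℝ.zeroʳ x) (ℝ.*-identityʳ y)) (ℝ.+-identityˡ y)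

    *ᶜ-distribʳ : ∀ w z t → ((z +ᶜ t) *ᶜ w) ≈ᶜ ((z *ᶜ w) +ᶜ (t *ᶜ w))
    *ᶜ-distribʳ (u , v) (x , y) (s , t) = (begin
      (x + s) * u - (y + t) * v
        ≈⟨ sub _ _ ⟩
      (x + s) * u + ν * ((y + t) * v)
        ≈⟨ solve 7 (λ ν x y u v s t →
             (x :+ s) :* u :+ ν :* ((y :+ t) :* v) :=
             (x :* u :+ ν :* (y :* v)) :+ (s :* u :+ ν :* (t :* v)))
             ℝ.refl ν x y u v s t ⟩
      (x * u + ν * (y * v)) + (s * u + ν * (t * v))
        ≈⟨ ℝ.+-cong (sub _ _) (sub _ _) ⟨
      (x * u - y * v) + (s * u - t * v) ∎) ,
      solve 6 (λ x y u v s t →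
        (x :+ s) :* v :+ (y :+ t) :* u := (x :* v :+ y :* u) :+ (s :* v :+ t :* u))
        ℝ.refl x y u v s t

    ≈ᶜ-trans : ∀ {x y z} → x ≈ᶜ y → y ≈ᶜ z → x ≈ᶜ z
    ≈ᶜ-trans = AbelianGroup.trans ℝ²⁺

    isCommutativeRing : IsCommutativeRing _≈ᶜ_ _+ᶜ_ _*ᶜ_ -ᶜ_ 0ᶜ 1ᶜ
    isCommutativeRing = record
      { isRing = record
        { +-isAbelianGroup = AbelianGroup.isAbelianGroup ℝ²⁺
        ; *-cong           = *ᶜ-cong
        ; *-assoc          = *ᶜ-assoc
        ; *-identity       = (λ z → ≈ᶜ-trans (*ᶜ-comm 1ᶜ z) (*ᶜ-identityʳ z)) , *ᶜ-identityʳ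
        ; distrib          =
            (λ w z t → ≈ᶜ-trans (*ᶜ-comm w (z +ᶜ t))
              (≈ᶜ-trans (*ᶜ-distribʳ w z t)
                (AbelianGroup.∙-cong ℝ²⁺ (*ᶜ-comm z w) (*ᶜ-comm t w)))) ,
            *ᶜ-distribʳ
        }
      ; *-comm = *ᶜ-comm
      }

    #-shift : ∀ {x y u v} → x - y ≈ u - v → x # y → u # v
    #-shift eq x#y with d , dx≈1 , _ ← ℝ.#⇒invertible x#y =
      ℝ.invertibleˡ⇒# (d , ℝ.trans (ℝ.*-congˡ (ℝ.sym eq)) dx≈1)

    -#0⇒# : ∀ {x y} → x - y # 0# → x # y
    -#0⇒# = #-shift (ℝ.x-0≈x _)

    *#0⇒#0 : ∀ {x y} → x * y # 0# → y # 0#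
    *#0⇒#0 {x} {y} xy#0 with d , dxy≈1 , _ ← ℝ.#⇒invertible xy#0 =
      ℝ.invertibleˡ⇒# (d * x , (begin
        d * x * (y - 0#)    ≈⟨ ℝ.*-congˡ (ℝ.x-0≈x y) ⟩
        d * x * y           ≈⟨ ℝ.*-assoc d x y ⟩
        d * (x * y)         ≈⟨ ℝ.*-congˡ (ℝ.x-0≈x (x * y)) ⟨
        d * (x * y - 0#)    ≈⟨ dxy≈1 ⟩
        1#                  ∎))

    +#0⇒#0 : ∀ {x y} → x + y # 0# → x # 0# ⊎ y # 0#
    +#0⇒#0 {x} {y} x+y#0 with ℝ.#-cotrans x+y#0 x
    ... | inj₁ x+y#x = inj₂ (#-shift (ℝ.trans (ℝ.xyx⁻¹≈y x y) (ℝ.sym (ℝ.x-0≈x y))) x+y#x)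
    ... | inj₂ x#0   = inj₁ x#0

    -‿#0⇒#0 : ∀ {x} → - x # 0# → x # 0#
    -‿#0⇒#0 {x} = *#0⇒#0 ∘ ℝ.#-congʳ (ℝ.sym (ℝ.-1*x≈-x x))

    square-positive : ∀ {x} → x # 0# → 0# < x * x
    square-positive {x} x#0 with ℝ.#⇒<⊎> x#0
    ... | inj₂ 0<x = ℝ.*-positive 0<x 0<x
    ... | inj₁ x<0 = ℝ.<-respʳ-≈ -x*-x≈x*x (ℝ.*-positive 0<-x 0<-x)
      where
      0<-x : 0# < - x
      0<-x = ℝ.<-respˡ-≈ (ℝ.-‿inverseˡ x)
               (ℝ.<-respʳ-≈ (ℝ.+-identityʳ (- x)) (ℝ.+-monoʳ-< (- x) x<0))

      -x*-x≈x*x : - x * - x ≈ x * x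
      -x*-x≈x*x = begin
        - x * - x      ≈⟨ ℝ.-‿distribˡ-* x (- x) ⟨
        - (x * - x)    ≈⟨ ℝ.-‿cong (ℝ.-‿distribʳ-* x x) ⟨
        - (- (x * x))  ≈⟨ ℝ.-‿involutive (x * x) ⟩
        x * x          ∎

    normSq#0ˡ : ∀ {x} y → x # 0# → normSq (x , y) # 0#
    normSq#0ˡ {x} y x#0
      with ℝ.#-cotrans (ℝ.#-sym (ℝ.<⇒# (square-positive x#0))) (normSq (x , y))
    ... | inj₂ N#0  = N#0
    ... | inj₁ xx#N = ℝ.#-sym (ℝ.<⇒# (ℝ.<-trans (square-positive x#0) xx<N))
      where
      y#0 : y # 0#
      y#0 = *#0⇒#0 (#-shift (ℝ.trans (ℝ.xyx⁻¹≈y (x * x) (y * y)) (ℝ.sym (ℝ.x-0≈x (y * y))))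
                            (ℝ.#-sym xx#N))

      xx<N : x * x < normSq (x , y)
      xx<N = ℝ.<-respˡ-≈ (ℝ.+-identityʳ (x * x)) (ℝ.+-monoʳ-< (x * x) (square-positive y#0))

    normSq#0 : ∀ {z} → z #ᶜ 0ᶜ → normSq z # 0#
    normSq#0 {x , y} (inj₁ x#0) = normSq#0ˡ y x#0
    normSq#0 {x , y} (inj₂ y#0) = ℝ.#-congʳ (ℝ.+-comm (y * y) (x * x)) (normSq#0ˡ x y#0)

    conj*≈normSq : ∀ (z : ℂ) n → (z *ᶜ (proj₁ z * n , - (proj₂ z * n))) ≈ᶜ (normSq z * n , 0#)
    conj*≈normSq (x , y) n = (begin
      x * (x * n) - y * - (y * n)    ≈⟨ ℝ.+-congˡ (ℝ.-‿cong (ℝ.-‿distribʳ-* y (y * n))) ⟨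
      x * (x * n) - - (y * (y * n))  ≈⟨ ℝ.+-congˡ (ℝ.-‿involutive _) ⟩
      x * (x * n) + y * (y * n)      ≈⟨ solve 3 (λ x y n → x :* (x :* n) :+ y :* (y :* n) :=
                                                 (x :* x :+ y :* y) :* n) ℝ.refl x y n ⟩
      (x * x + y * y) * n            ∎) , (begin
      x * - (y * n) + y * (x * n)    ≈⟨ ℝ.+-congʳ (ℝ.-‿distribʳ-* x (y * n)) ⟨
      - (x * (y * n)) + y * (x * n)  ≈⟨ ℝ.+-congˡ (solve 3 (λ x y n → y :* (x :* n) :=
                                                  x :* (y :* n)) ℝ.refl x y n) ⟩
      - (x * (y * n)) + x * (y * n)  ≈⟨ ℝ.-‿inverseˡ _ ⟩
      0#                             ∎)

    #0⇒invertible : ∀ {z} → z #ᶜ 0ᶜ → Invertible _≈ᶜ_ 1ᶜ _*ᶜ_ z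
    #0⇒invertible {z@(x , y)} z#0 with n , _ , Nn≈1 ← ℝ.#⇒invertible (normSq#0 z#0) =
      w , ≈ᶜ-trans (*ᶜ-comm w z) zw≈1 , zw≈1
      where
      w : ℂ
      w = x * n , - (y * n)

      zw≈1 : (z *ᶜ w) ≈ᶜ 1ᶜ
      zw≈1 = ≈ᶜ-trans (conj*≈normSq z n)
               (ℝ.trans (ℝ.*-congʳ (ℝ.sym (ℝ.x-0≈x (normSq z)))) Nn≈1 , ℝ.refl)

    #ᶜ⇒invertible : ∀ {z w} → z #ᶜ w → Invertible _≈ᶜ_ 1ᶜ _*ᶜ_ (z +ᶜ (-ᶜ w))
    #ᶜ⇒invertible = #0⇒invertible ∘ Sum.map difference difference
      where
      difference : ∀ {x y} → x # y → x - y # 0#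
      difference = #-shift (ℝ.sym (ℝ.x-0≈x _))

    invertible⇒#ᶜ : ∀ {z w} → Invertible _≈ᶜ_ 1ᶜ _*ᶜ_ (z +ᶜ (-ᶜ w)) → z #ᶜ w
    invertible⇒#ᶜ ((u , v) , (eq , _) , _) =
      Sum.map (-#0⇒# ∘ *#0⇒#0) (-#0⇒# ∘ *#0⇒#0 ∘ -‿#0⇒#0)
        (+#0⇒#0 (ℝ.#-congʳ (ℝ.sym eq) ℝ.1#0))

  complexField : HeytingField c ℓ₁ ℓ₂
  complexField = record
    { Carrier        = ℂ
    ; _≈_            = _≈ᶜ_
    ; _#_            = _#ᶜ_
    ; _+_            = _+ᶜ_
    ; _*_            = _*ᶜ_
    ; -_             = -ᶜ_
    ; 0#             = 0ᶜ
    ; 1#             = 1ᶜ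
    ; isHeytingField = record
      { isHeytingCommutativeRing = record
        { isCommutativeRing   = isCommutativeRing
        ; isApartnessRelation = record
          { irrefl  = λ (p , q) → [ ℝ.#-irrefl p , ℝ.#-irrefl q ]′
          ; sym     = Sum.map ℝ.#-sym ℝ.#-sym
          ; cotrans = λ where
              (inj₁ x#u) (s , _) → Sum.map inj₁ inj₁ (ℝ.#-cotrans x#u s)
              (inj₂ y#v) (_ , t) → Sum.map inj₂ inj₂ (ℝ.#-cotrans y#v t)
          }
        ; #⇒invertible = #ᶜ⇒invertible
        ; invertible⇒# = invertible⇒#ᶜ
        }
      ; tight = λ (x , y) (u , v) →
          (λ ¬# → proj₁ (ℝ.tight x u) (¬# ∘ inj₁) , proj₁ (ℝ.tight y v) (¬# ∘ inj₂)) ,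
          (λ (p , q) → [ proj₂ (ℝ.tight x u) p , proj₂ (ℝ.tight y v) q ]′)
      }
    }

  private
    module ℂ where
      open HeytingField complexField public
      open HeytingFieldOperations complexField public

  -- ∣ z ∣< r says that the modulus of z is less than r, avoiding square roots.
  infix 4 ∣_∣<_
  ∣_∣<_ : ℂ → Carrier → Set ℓ₂
  ∣ z ∣< r = 0# < r × normSq z < r * r

  infix 4 _⟶_
  _⟶_ : (ℕ → ℂ) → ℂ → Set (c ⊔ ℓ₂)
  s ⟶ l = ∀ ε → 0# < ε → ∃[ N ] ∀ n → N ℕ.≤ n → ∣ s n ℂ.- l ∣< ε

  HasSum : (ℕ → ℂ) → ℂ → Set (c ⊔ ℓ₂)
  HasSum t S = ℂ.partialSum t ⟶ S

  -- (x;q)∞ = P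
  infix 4 [_⨟_]∞≔_
  [_⨟_]∞≔_ : ℂ → ℂ → ℂ → Set (c ⊔ ℓ₂)
  [ x ⨟ q ]∞≔ P = (λ n → ℂ.[ x ⨟ q ] n) ⟶ P

{-# OPTIONS --safe #-}

-- Let tᵣ(a) be the summand, x = a²q/b and f(a) = (1+a)(1-a²q)(1-aq/b) / ((1-x)(1-xq)).
-- There is a telescoping relation tᵣ(a) - f(a) tᵣ(aq) = Gᵣ₊₁ - Gᵣ. Iterating it n times,
-- the partial sum for a is f(a) f(aq) ⋯ f(aqⁿ⁻¹) times the partial sum for aqⁿ, plus n
-- remainders. If |q| ≤ ρ < 1, then the partial sum for aqⁿ is 1 + O(ρⁿ) and the remainder of
-- step k in the partial sum of length n + 1 is O(ρᵏ⁺ⁿ), both uniformly, while the product of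
-- the f's is a quotient of finite products that converges to the right-hand side. All limits
-- are geometric with ratio ρ, so that only bounds of the form O(ρⁿ) are needed.

module Submission where

open import Defs
open import Algebra.Apartness.Bundles using (HeytingCommutativeRing; HeytingField)
open import Algebra.Bundles using (CommutativeRing; Semiring)
import Algebra.Definitions.RawSemiring as RawSemiringDefinitions
open import Data.Fin.Base using (toℕ)
open import Data.Nat.Base as ℕ using (ℕ; zero; suc)
import Data.Nat.Divisibility as ℕ
import Data.Nat.DivMod as ℕ
import Data.Nat.Properties as ℕ
import Data.Nat.Solver as ℕ
open import Data.Product.Base using (Σ-syntax; ∃-syntax; _×_; _,_; proj₁; proj₂)
open import Data.Sum.Base using (_⊎_; inj₁; inj₂)
open import Function.Base using (_∘_; id)
open import Level using (Level; _⊔_) renaming (suc to lsuc)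
open import Relation.Nullary.Negation.Core using (¬_; contradiction)
import Relation.Binary.PropositionalEquality.Core as ≡
import Relation.Binary.Reasoning.Setoid as SetoidReasoning

-- The factor f is not guessed: it is the right-hand side at a divided by the right-hand side at aq.
-- The shift from a to aq multiplies x by q², so each step consumes two factors of (x;q)∞ but only
-- one of each of the other products. Letting the truncation grow first would give S(a) = f(a)
-- S(aq), at the price of knowing that every S(aqᵏ) converges and of a second limit in k. Tying the
-- number of iterations to the truncation leaves a single limit and makes convergence of the series
-- a conclusion; this is why the estimates are uniform in two indices. Two obstacles shape the rest.
-- The quantities a, q, 1 - a and 1 + aqʳ may all vanish, so nothing is divided by them: the
-- telescoping relation becomes a polynomial identity with explicit inverses only for the genuine
-- denominators. And the order on the reals need not be decidable, so moduli enter only through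
-- upper bounds, and apartness from zero is obtained by exhibiting an inverse or a strict
-- inequality.

-- Ring solver with integer coefficients, whose equality is decidable even if that of the ring is
-- not.

module IntegerRingSolver {c ℓ} (R : CommutativeRing c ℓ) where
  open import Algebra.Solver.Ring.AlmostCommutativeRing
    using (_-Raw-AlmostCommutative⟶_; fromCommutativeRing)
  import Algebra.Properties.AbelianGroup as AbelianGroupProperties
  import Algebra.Properties.Ring as RingProperties
  import Algebra.Properties.Semiring.Mult.TCOptimised as Mult
  import Algebra.Solver.Ring as RingSolver
  import Data.Integer.Base as ℤ
  import Data.Integer.Properties as ℤₚ
  open import Data.Maybe.Base using (Maybe; just; nothing)
  open import Data.Sign.Base as Sign using (Sign)
  open import Relation.Nullary.Decidable.Core using (yes; no)
  open ℤ using (ℤ; +_; -[1+_]; _⊖_; _◃_)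
  open CommutativeRing R
  open RingProperties ring using (-0#≈0#; -‿involutive; -‿distribˡ-*; -‿distribʳ-*)
  open AbelianGroupProperties +-abelianGroup using (⁻¹-∙-comm)
  open Mult semiring using (1+×; ×-homo-+; ×1-homo-*) renaming (_×_ to infixl 8 _·_)
  open import Relation.Binary.Reasoning.Setoid setoid

  private
    ⟦_⟧ : ℤ → Carrier
    ⟦ + n ⟧      = n · 1#
    ⟦ -[1+ n ] ⟧ = - (suc n · 1#)

    ⊖-homo : ∀ m n → ⟦ m ⊖ n ⟧ ≈ m · 1# - n · 1#
    ⊖-homo zero    zero    = sym (-‿inverseʳ 0#)
    ⊖-homo zero    (suc n) = sym (+-identityˡ _)
    ⊖-homo (suc m) zero    = sym (trans (+-congˡ -0#≈0#) (+-identityʳ _))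
    ⊖-homo (suc m) (suc n) = begin
      ⟦ suc m ⊖ suc n ⟧                   ≡⟨ ≡.cong ⟦_⟧ (ℤₚ.[1+m]⊖[1+n]≡m⊖n m n) ⟩
      ⟦ m ⊖ n ⟧                           ≈⟨ ⊖-homo m n ⟩
      m · 1# - n · 1#                     ≈⟨ +-congʳ (trans (+-congʳ (-‿inverseʳ 1#)) (+-identityˡ _)) ⟨
      1# - 1# + m · 1# - n · 1#           ≈⟨ +-congʳ (trans (+-assoc _ _ _) (trans (+-congˡ (+-comm _ _)) (sym (+-assoc _ _ _)))) ⟩
      1# + m · 1# + - 1# - n · 1#         ≈⟨ +-assoc _ _ _ ⟩
      1# + m · 1# + (- 1# - n · 1#)       ≈⟨ +-cong (sym (1+× m 1#)) (trans (⁻¹-∙-comm _ _) (-‿cong (sym (1+× n 1#)))) ⟩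
      suc m · 1# - suc n · 1#             ∎

    +-homo : ∀ i j → ⟦ i ℤ.+ j ⟧ ≈ ⟦ i ⟧ + ⟦ j ⟧
    +-homo (+ m)    (+ n)    = ×-homo-+ 1# m n
    +-homo (+ m)    -[1+ n ] = ⊖-homo m (suc n)
    +-homo -[1+ m ] (+ n)    = trans (⊖-homo n (suc m)) (+-comm _ _)
    +-homo -[1+ m ] -[1+ n ] = begin
      - (suc (suc (m ℕ.+ n)) · 1#)          ≈⟨ -‿cong (1+× (suc (m ℕ.+ n)) 1#) ⟩
      - (1# + suc (m ℕ.+ n) · 1#)           ≈⟨ -‿cong (+-congˡ (×-homo-+ 1# (suc m) n)) ⟩
      - (1# + (suc m · 1# + n · 1#))        ≈⟨ -‿cong (trans (sym (+-assoc _ _ _)) (trans (+-congʳ (+-comm _ _)) (+-assoc _ _ _))) ⟩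
      - (suc m · 1# + (1# + n · 1#))        ≈⟨ -‿cong (+-congˡ (1+× n 1#)) ⟨
      - (suc m · 1# + suc n · 1#)           ≈⟨ ⁻¹-∙-comm _ _ ⟨
      - (suc m · 1#) - suc n · 1#           ∎

    -◃-homo : ∀ n → ⟦ Sign.- ◃ n ⟧ ≈ - (n · 1#)
    -◃-homo zero    = sym -0#≈0#
    -◃-homo (suc n) = refl

    +◃-homo : ∀ n → ⟦ Sign.+ ◃ n ⟧ ≈ n · 1#
    +◃-homo zero    = refl
    +◃-homo (suc n) = refl

    *-homo : ∀ i j → ⟦ i ℤ.* j ⟧ ≈ ⟦ i ⟧ * ⟦ j ⟧
    *-homo (+ m)    (+ n)    = trans (+◃-homo (m ℕ.* n)) (×1-homo-* m n)
    *-homo (+ m)    -[1+ n ] =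
      trans (-◃-homo (m ℕ.* suc n)) (trans (-‿cong (×1-homo-* m (suc n))) (-‿distribʳ-* _ _))
    *-homo -[1+ m ] (+ n)    =
      trans (-◃-homo (suc m ℕ.* n)) (trans (-‿cong (×1-homo-* (suc m) n)) (-‿distribˡ-* _ _))
    *-homo -[1+ m ] -[1+ n ] = begin
      (suc m ℕ.* suc n) · 1#           ≈⟨ ×1-homo-* (suc m) (suc n) ⟩
      suc m · 1# * suc n · 1#          ≈⟨ -‿involutive _ ⟨
      - - (suc m · 1# * suc n · 1#)    ≈⟨ -‿cong (-‿distribˡ-* _ _) ⟩
      - (- (suc m · 1#) * suc n · 1#)  ≈⟨ -‿distribʳ-* _ _ ⟩
      - (suc m · 1#) * - (suc n · 1#)  ∎

    -‿homo : ∀ i → ⟦ ℤ.- i ⟧ ≈ - ⟦ i ⟧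
    -‿homo (+ zero)  = sym -0#≈0#
    -‿homo (+ suc n) = refl
    -‿homo -[1+ n ]  = sym (-‿involutive _)

    morphism : ℤ.+-*-rawRing -Raw-AlmostCommutative⟶ fromCommutativeRing R
    morphism = record
      { ⟦_⟧    = ⟦_⟧
      ; +-homo = +-homo
      ; *-homo = *-homo
      ; -‿homo = -‿homo
      ; 0-homo = refl
      ; 1-homo = refl
      }

    _≟_ : ∀ i j → Maybe (⟦ i ⟧ ≈ ⟦ j ⟧)
    i ≟ j with i ℤₚ.≟ j
    ... | yes ≡.refl = just refl
    ... | no  _      = nothing

  open RingSolver ℤ.+-*-rawRing (fromCommutativeRing R) morphism _≟_ public
    using (Polynomial; solve; con; _:+_; _:*_; _:-_; :-_; _:=_)

  :1 : ∀ {n} → Polynomial n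
  :1 = con ℤ.1ℤ

  :0 : ∀ {n} → Polynomial n
  :0 = con ℤ.0ℤ

-- Apartness from zero as invertibility.

module InvertibleElements {c ℓ₁ ℓ₂} (F : HeytingField c ℓ₁ ℓ₂) where
  open HeytingField F
  open import Algebra.Apartness.Properties.HeytingCommutativeRing heytingCommutativeRing
    using (x-0≈x; invertibleˡ⇒#)

  commutativeRing : CommutativeRing c ℓ₁
  commutativeRing = HeytingCommutativeRing.commutativeRing heytingCommutativeRing

  open IntegerRingSolver commutativeRing

  abstract
    inverse⇒#0 : ∀ {x u} → x * u ≈ 1# → x # 0#
    inverse⇒#0 {x} {u} xu≈1 = invertibleˡ⇒# (u , trans (*-congˡ (x-0≈x x)) (trans (*-comm u x) xu≈1))

    *-inverseʳ : ∀ {x} (x#0 : x # 0#) → x * proj₁ (#⇒invertible x#0) ≈ 1#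
    *-inverseʳ {x} x#0 = trans (*-congʳ (sym (x-0≈x x))) (proj₂ (proj₂ (#⇒invertible x#0)))

    *#0⇒#0ˡ : ∀ {x y} → x * y # 0# → x # 0#
    *#0⇒#0ˡ {x} {y} xy#0 = inverse⇒#0 (trans (sym (*-assoc _ _ _)) (*-inverseʳ xy#0))

    *#0⇒#0ʳ : ∀ {x y} → x * y # 0# → y # 0#
    *#0⇒#0ʳ {x} {y} xy#0 = inverse⇒#0 (trans (sym (*-assoc _ _ _)) (trans (*-congʳ (*-comm y x)) (*-inverseʳ xy#0)))

    inverse-unique : ∀ {x u v} → x * u ≈ 1# → x * v ≈ 1# → u ≈ v
    inverse-unique {x} {u} {v} xu≈1 xv≈1 = trans (sym (*-identityʳ u)) (trans (*-congˡ (sym xv≈1))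
      (trans (solve 3 (λ x u v → u :* (x :* v) :=
           x :* u :* v) refl x u v) (trans (*-congʳ xu≈1) (*-identityˡ v))))

-- Order and arithmetic of the real numbers.

module RealProperties {c ℓ₁ ℓ₂} (ℝ : RealField c ℓ₁ ℓ₂) where
  open import Algebra.Apartness.Properties.HeytingCommutativeRing (RealField.heytingCommutativeRing ℝ)
    using (1#0)
  import Algebra.Properties.Semiring.Exp as Exp
  import Algebra.Properties.Semiring.Mult as Mult
  open import Relation.Binary.Structures using (IsPreorder)
  open RealField ℝ

  open InvertibleElements heytingField public using (commutativeRing)
  open CommutativeRing commutativeRing using (semiring)
  open HeytingFieldOperations heytingField public using (_^_)
  open Exp semiring public using (^-homo-*)
  open Mult semiring using (×-homo-+) renaming (_×_ to _·_)
  open IntegerRingSolver commutativeRing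
  open InvertibleElements heytingField hiding (commutativeRing)

  infix 4 _≤_
  -- As a negation, this is proved by refuting the opposite strict inequality, which supplies a
  -- positive gap to compute with.
  _≤_ : Carrier → Carrier → Set ℓ₂
  x ≤ y = ¬ (y < x)

  <-asym : ∀ {x y} → x < y → ¬ (y < x)
  <-asym x<y y<x = <-irrefl refl (<-trans x<y y<x)

  <⇒≤ : ∀ {x y} → x < y → x ≤ y
  <⇒≤ = <-asym

  <-cotrans : ∀ {x y} → x < y → ∀ z → x < z ⊎ z < y
  <-cotrans x<y z with #-cotrans (<⇒# x<y) z
  <-cotrans x<y z | inj₁ x#z with #⇒<⊎> x#z
  ... | inj₁ x<z = inj₁ x<z
  ... | inj₂ z<x = inj₂ (<-trans z<x x<y)
  <-cotrans x<y z | inj₂ z#y with #⇒<⊎> z#y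
  ... | inj₁ z<y = inj₂ z<y
  ... | inj₂ y<z = inj₁ (<-trans x<y y<z)

  <-≤-trans : ∀ {x y z} → x < y → y ≤ z → x < z
  <-≤-trans {z = z} x<y y≤z with <-cotrans x<y z
  ... | inj₁ x<z = x<z
  ... | inj₂ z<y = contradiction z<y y≤z

  ≤-<-trans : ∀ {x y z} → x ≤ y → y < z → x < z
  ≤-<-trans {x} x≤y y<z with <-cotrans y<z x
  ... | inj₁ y<x = contradiction y<x x≤y
  ... | inj₂ x<z = x<z

  ≤-isPreorder : IsPreorder _≈_ _≤_
  ≤-isPreorder = record
    { isEquivalence = isEquivalence
    ; reflexive     = λ x≈y y<x → <-irrefl (sym x≈y) y<x
    ; trans         = λ x≤y y≤z z<x → y≤z (<-≤-trans z<x x≤y)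
    }

  open IsPreorder ≤-isPreorder public using ()
    renaming (reflexive to ≤-reflexive; refl to ≤-refl; trans to ≤-trans)

  module ≤-Reasoning where
    open import Relation.Binary.Reasoning.Base.Triple ≤-isPreorder
      <-asym <-trans <-resp-≈ <⇒≤ <-≤-trans ≤-<-trans public

  open ≤-Reasoning

  <⇒0<- : ∀ {x y} → x < y → 0# < y - x
  <⇒0<- {x} {y} x<y = <-respˡ-≈ (-‿inverseˡ x) (<-respʳ-≈ (+-comm (- x) y) (+-monoʳ-< (- x) x<y))

  0<-⇒< : ∀ {x y d} → x + d ≈ y → 0# < d → x < y
  0<-⇒< {x} x+d≈y 0<d = <-respˡ-≈ (+-identityʳ x) (<-respʳ-≈ x+d≈y (+-monoʳ-< x 0<d))

  ≤⇒0≤- : ∀ {x y} → x ≤ y → 0# ≤ y - x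
  ≤⇒0≤- {x} {y} x≤y y-x<0 =
    x≤y (0<-⇒< (solve 2 (λ x y → y :+ (:0 :- (y :- x)) := x) refl x y) (<⇒0<- y-x<0))

  0≤-⇒≤ : ∀ {x y d} → x + d ≈ y → 0# ≤ d → x ≤ y
  0≤-⇒≤ {x} {y} {d} x+d≈y 0≤d y<x = 0≤d (0<-⇒< (begin-equality
    d + (x - y)       ≈⟨ +-congˡ (+-congˡ (-‿cong (sym x+d≈y))) ⟩
    d + (x - (x + d)) ≈⟨ solve 2 (λ x d → d :+ (x :- (x :+ d)) := :0) refl x d ⟩
    0#                ∎) (<⇒0<- y<x))

  +-mono-≤ : ∀ {x y u v} → x ≤ y → u ≤ v → x + u ≤ y + v
  +-mono-≤ {x} {y} {u} {v} x≤y u≤v =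
    ≤-trans (mono u x≤y) (≤-trans (≤-reflexive (+-comm y u)) (≤-trans (mono y u≤v) (≤-reflexive (+-comm v y))))
    where
    mono : ∀ z {x y} → x ≤ y → x + z ≤ y + z
    mono z {x} {y} x≤y y+z<x+z = x≤y (0<-⇒<
      (solve 3 (λ x y z → y :+ (x :+ z :- (y :+ z)) := x) refl x y z) (<⇒0<- y+z<x+z))

  +-monoʳ-≤ : ∀ x {u v} → u ≤ v → x + u ≤ x + v
  +-monoʳ-≤ x = +-mono-≤ ≤-refl

  +-monoˡ-≤ : ∀ x {u v} → u ≤ v → u + x ≤ v + x
  +-monoˡ-≤ x u≤v = +-mono-≤ u≤v ≤-refl

  +-nonneg : ∀ {x y} → 0# ≤ x → 0# ≤ y → 0# ≤ x + y
  +-nonneg 0≤x 0≤y = ≤-trans (≤-reflexive (sym (+-identityʳ 0#))) (+-mono-≤ 0≤x 0≤y)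

  x≤x+y : ∀ {x y} → 0# ≤ y → x ≤ x + y
  x≤x+y = 0≤-⇒≤ refl

  0≤∧#⇒0< : ∀ {x} → 0# ≤ x → x # 0# → 0# < x
  0≤∧#⇒0< 0≤x x#0 with #⇒<⊎> x#0
  ... | inj₁ x<0 = contradiction x<0 0≤x
  ... | inj₂ 0<x = 0<x

  -- A negative product is invertible, hence so are both factors; being nonnegative they are then
  -- positive, and so is the product.
  *-nonneg : ∀ {x y} → 0# ≤ x → 0# ≤ y → 0# ≤ x * y
  *-nonneg 0≤x 0≤y xy<0 =
    <-asym xy<0 (*-positive (0≤∧#⇒0< 0≤x (*#0⇒#0ˡ (<⇒# xy<0))) (0≤∧#⇒0< 0≤y (*#0⇒#0ʳ (<⇒# xy<0))))

  *-monoʳ-≤ : ∀ {z x y} → 0# ≤ z → x ≤ y → z * x ≤ z * y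
  *-monoʳ-≤ {z} {x} {y} 0≤z x≤y =
    0≤-⇒≤ (solve 3 (λ x y z → z :* x :+ z :* (y :- x) := z :* y) refl x y z) (*-nonneg 0≤z (≤⇒0≤- x≤y))

  *-monoˡ-≤ : ∀ {z x y} → 0# ≤ z → x ≤ y → x * z ≤ y * z
  *-monoˡ-≤ {z} {x} {y} 0≤z x≤y = begin
    x * z  ≈⟨ *-comm x z ⟩
    z * x  ≤⟨ *-monoʳ-≤ 0≤z x≤y ⟩
    z * y  ≈⟨ *-comm z y ⟩
    y * z  ∎

  *-mono-≤ : ∀ {x y u v} → 0# ≤ x → 0# ≤ v → x ≤ y → u ≤ v → x * u ≤ y * v
  *-mono-≤ 0≤x 0≤v x≤y u≤v = ≤-trans (*-monoʳ-≤ 0≤x u≤v) (*-monoˡ-≤ 0≤v x≤y)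

  square-nonneg : ∀ x → 0# ≤ x * x
  square-nonneg x xx<0 with #⇒<⊎> (*#0⇒#0ˡ (<⇒# xx<0))
  ... | inj₂ 0<x = <-asym xx<0 (*-positive 0<x 0<x)
  ... | inj₁ x<0 = <-asym xx<0 (<-respʳ-≈ -x*-x≈x*x (*-positive (<⇒0<- x<0) (<⇒0<- x<0)))
    where
    -x*-x≈x*x : (0# - x) * (0# - x) ≈ x * x
    -x*-x≈x*x = solve 1 (λ x → (:0 :- x) :* (:0 :- x) := x :* x) refl x

  0<1 : 0# < 1#
  0<1 = 0≤∧#⇒0< (≤-trans (square-nonneg 1#) (≤-reflexive (*-identityˡ 1#))) 1#0

  0≤1 : 0# ≤ 1#
  0≤1 = <⇒≤ 0<1

  -- Stands in for taking square roots: y < x would make (x - y)(x + y) positive.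
  square-≤⇒≤ : ∀ {x y} → 0# ≤ y → x * x ≤ y * y → x ≤ y
  square-≤⇒≤ {x} {y} 0≤y xx≤yy y<x = xx≤yy (0<-⇒<
    (solve 2 (λ x y → y :* y :+ (x :- y) :* (x :+ y) := x :* x) refl x y)
    (*-positive (<⇒0<- y<x) (<-≤-trans (≤-<-trans 0≤y y<x) (x≤x+y 0≤y))))

  abstract
    -- A negative inverse would make 1 negative; strictness follows because the inverse is itself
    -- invertible.
    positive⇒inverse : ∀ {x} → 0# < x → ∃[ y ] 0# < y × x * y ≈ 1#
    positive⇒inverse {x} 0<x = y , 0≤∧#⇒0< 0≤y (*#0⇒#0ʳ (inverse⇒#0 (trans (*-identityʳ _) xy≈1))) , xy≈1
      where
      x#0 : x # 0#
      x#0 = #-sym (<⇒# 0<x)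
      y : Carrier
      y = proj₁ (#⇒invertible x#0)
      xy≈1 : x * y ≈ 1#
      xy≈1 = *-inverseʳ x#0
      0≤y : 0# ≤ y
      0≤y y<0 = <-asym 0<1 (<-respˡ-≈ xy≈1 (0<-⇒< (solve 2 (λ x y → x :* y :+ x :* (:0 :- y) :=
           :0) refl x y)
                             (*-positive 0<x (<⇒0<- y<0))))

  abstract
    half : ∃[ h ] 0# < h × (1# + 1#) * h ≈ 1#
    half = positive⇒inverse (<-≤-trans 0<1 (x≤x+y 0≤1))

  ½ : Carrier
  ½ = proj₁ half

  0<½ : 0# < ½
  0<½ = proj₁ (proj₂ half)

  2*½≈1 : (1# + 1#) * ½ ≈ 1#
  2*½≈1 = proj₂ (proj₂ half)

  x*½+x*½≈x : ∀ x → x * ½ + x * ½ ≈ x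
  x*½+x*½≈x x = begin-equality
    x * ½ + x * ½      ≈⟨ solve 2 (λ x h → x :* h :+ x :* h := x :* ((:1 :+ :1) :* h)) refl x ½ ⟩
    x * ((1# + 1#) * ½) ≈⟨ *-congˡ 2*½≈1 ⟩
    x * 1#             ≈⟨ *-identityʳ x ⟩
    x                  ∎

  0<x*½ : ∀ {x} → 0# < x → 0# < x * ½
  0<x*½ 0<x = *-positive 0<x 0<½

  x*½<x : ∀ {x} → 0# < x → x * ½ < x
  x*½<x {x} 0<x = 0<-⇒< (x*½+x*½≈x x) (0<x*½ 0<x)

  0≤n·1 : ∀ n → 0# ≤ n · 1#
  0≤n·1 zero    = ≤-refl
  0≤n·1 (suc n) = +-nonneg 0≤1 (0≤n·1 n)

  ·1-mono-≤ : ∀ {m n} → m ℕ.≤ n → m · 1# ≤ n · 1#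
  ·1-mono-≤ {m} m≤n with k , ≡.refl ← ℕ.m≤n⇒∃[o]m+o≡n m≤n =
    ≤-trans (x≤x+y (0≤n·1 k)) (≤-reflexive (sym (×-homo-+ 1# m k)))

  -- Geometric decay, geometric sums and products.

  module Geometric {ρ : Carrier} (0≤ρ : 0# ≤ ρ) (ρ<1 : ρ < 1#) where

    0<1-ρ : 0# < 1# - ρ
    0<1-ρ = <⇒0<- ρ<1

    0≤ρ^ : ∀ n → 0# ≤ ρ ^ n
    0≤ρ^ zero    = 0≤1
    0≤ρ^ (suc n) = *-nonneg 0≤ρ (0≤ρ^ n)

    ρ^≤1 : ∀ n → ρ ^ n ≤ 1#
    ρ^≤1 zero    = ≤-refl
    ρ^≤1 (suc n) = ≤-trans (*-mono-≤ 0≤ρ 0≤1 (<⇒≤ ρ<1) (ρ^≤1 n)) (≤-reflexive (*-identityˡ 1#))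

    ρ^m+n≤ρ^n : ∀ m n → ρ ^ (m ℕ.+ n) ≤ ρ ^ n
    ρ^m+n≤ρ^n m n = begin
      ρ ^ (m ℕ.+ n)  ≈⟨ ^-homo-* ρ m n ⟩
      ρ ^ m * ρ ^ n  ≤⟨ *-monoˡ-≤ (0≤ρ^ n) (ρ^≤1 m) ⟩
      1# * ρ ^ n     ≈⟨ *-identityˡ _ ⟩
      ρ ^ n          ∎

    -- Each step is a convex combination with weights 1 - ρ and ρ of two quantities that are at most
    -- 1. The resulting decay like 1/n suffices for the Archimedean axiom, and unlike Bernoulli's
    -- inequality for 1/ρ it allows ρ = 0.
    n·[1-ρ]*ρ^n≤1 : ∀ n → n · 1# * (1# - ρ) * ρ ^ n ≤ 1#
    n·[1-ρ]*ρ^n≤1 zero    = ≤-trans (≤-reflexive (trans (*-congʳ (zeroˡ _)) (zeroˡ _))) 0≤1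
    n·[1-ρ]*ρ^n≤1 (suc n) = begin
      (1# + n · 1#) * (1# - ρ) * (ρ * ρ ^ n)
        ≈⟨ solve 3 (λ ρ k p → (:1 :+ k) :* (:1 :- ρ) :* (ρ :* p) := (:1 :- ρ) :* (ρ :* p) :+ ρ :* (k :* (:1 :- ρ) :* p))
             refl ρ (n · 1#) (ρ ^ n) ⟩
      (1# - ρ) * ρ ^ suc n + ρ * (n · 1# * (1# - ρ) * ρ ^ n)
        ≤⟨ +-mono-≤ (*-monoʳ-≤ (<⇒≤ 0<1-ρ) (ρ^≤1 (suc n))) (*-monoʳ-≤ 0≤ρ (n·[1-ρ]*ρ^n≤1 n)) ⟩
      (1# - ρ) * 1# + ρ * 1#
        ≈⟨ solve 1 (λ ρ → (:1 :- ρ) :* :1 :+ ρ :* :1 := :1) refl ρ ⟩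
      1# ∎

    abstract
      K*ρ^n→0 : ∀ K ε → 0# < ε → ∃[ N ] ∀ n → N ℕ.≤ n → K * ρ ^ n ≤ ε
      K*ρ^n→0 K ε 0<ε = proj₁ large , bound
        where
        0<ε[1-ρ] : 0# < ε * (1# - ρ)
        0<ε[1-ρ] = *-positive 0<ε 0<1-ρ

        η : Carrier
        η = proj₁ (positive⇒inverse 0<ε[1-ρ])

        ε[1-ρ]η≈1 : ε * (1# - ρ) * η ≈ 1#
        ε[1-ρ]η≈1 = proj₂ (proj₂ (positive⇒inverse 0<ε[1-ρ]))

        -- Since η inverts ε (1 - ρ), this N satisfies K ≤ N ε (1 - ρ), which is what the previous
        -- bound on ρⁿ absorbs.
        large : ∃[ N ] K * η < N · 1#
        large = archimedean (K * η)

        bound : ∀ n → proj₁ large ℕ.≤ n → K * ρ ^ n ≤ ε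
        bound n N≤n = begin
          K * ρ ^ n
            ≈⟨ *-congʳ (trans (sym (*-identityʳ K)) (*-congˡ (sym ε[1-ρ]η≈1))) ⟩
          K * (ε * (1# - ρ) * η) * ρ ^ n
            ≈⟨ solve 5 (λ K ε δ η p → K :* (ε :* δ :* η) :* p :=
                 K :* η :* (ε :* δ :* p)) refl K ε (1# - ρ) η (ρ ^ n) ⟩
          K * η * (ε * (1# - ρ) * ρ ^ n)
            ≤⟨ *-monoˡ-≤ (*-nonneg (<⇒≤ 0<ε[1-ρ]) (0≤ρ^ n)) (≤-trans (<⇒≤ (proj₂ large)) (·1-mono-≤ N≤n)) ⟩
          n · 1# * (ε * (1# - ρ) * ρ ^ n)
            ≈⟨ solve 4 (λ k ε δ p → k :* (ε :* δ :* p) :=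
                 ε :* (k :* δ :* p)) refl (n · 1#) ε (1# - ρ) (ρ ^ n) ⟩
          ε * (n · 1# * (1# - ρ) * ρ ^ n)
            ≤⟨ *-monoʳ-≤ (<⇒≤ 0<ε) (n·[1-ρ]*ρ^n≤1 n) ⟩
          ε * 1#
            ≈⟨ *-identityʳ ε ⟩
          ε ∎

    geometricSum : ℕ → Carrier
    geometricSum zero    = 0#
    geometricSum (suc n) = geometricSum n + ρ ^ n

    abstract
      inverse[1-ρ] : ∃[ y ] 0# < y × (1# - ρ) * y ≈ 1#
      inverse[1-ρ] = positive⇒inverse 0<1-ρ

    1/[1-ρ] : Carrier
    1/[1-ρ] = proj₁ inverse[1-ρ]

    0≤1/[1-ρ] : 0# ≤ 1/[1-ρ]
    0≤1/[1-ρ] = <⇒≤ (proj₁ (proj₂ inverse[1-ρ]))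

    [1-ρ]*1/[1-ρ]≈1 : (1# - ρ) * 1/[1-ρ] ≈ 1#
    [1-ρ]*1/[1-ρ]≈1 = proj₂ (proj₂ inverse[1-ρ])

    geometricSum-closed : ∀ n → (1# - ρ) * geometricSum n ≈ 1# - ρ ^ n
    geometricSum-closed zero    = trans (zeroʳ _) (sym (-‿inverseʳ 1#))
    geometricSum-closed (suc n) = begin-equality
      (1# - ρ) * (geometricSum n + ρ ^ n)           ≈⟨ distribˡ _ _ _ ⟩
      (1# - ρ) * geometricSum n + (1# - ρ) * ρ ^ n  ≈⟨ +-congʳ (geometricSum-closed n) ⟩
      1# - ρ ^ n + (1# - ρ) * ρ ^ n                 ≈⟨ solve 2 (λ ρ p → :1 :- p :+ (:1 :- ρ) :* p :=
           :1 :- ρ :* p) refl ρ (ρ ^ n) ⟩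
      1# - ρ ^ suc n                                ∎

    geometricSum≤ : ∀ n → geometricSum n ≤ 1/[1-ρ]
    geometricSum≤ n = begin
      geometricSum n                         ≈⟨ trans (sym (*-identityˡ _)) (*-congʳ (sym [1-ρ]*1/[1-ρ]≈1)) ⟩
      (1# - ρ) * 1/[1-ρ] * geometricSum n    ≈⟨ solve 3 (λ d i s → d :* i :* s :=
           i :* (d :* s)) refl (1# - ρ) 1/[1-ρ] (geometricSum n) ⟩
      1/[1-ρ] * ((1# - ρ) * geometricSum n)  ≈⟨ *-congˡ (geometricSum-closed n) ⟩
      1/[1-ρ] * (1# - ρ ^ n)                 ≤⟨ *-monoʳ-≤ 0≤1/[1-ρ] (0≤-⇒≤ (solve 1 (λ p → :1 :- p :+ p :=
           :1) refl (ρ ^ n)) (0≤ρ^ n)) ⟩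
      1/[1-ρ] * 1#                           ≈⟨ *-identityʳ _ ⟩
      1/[1-ρ]                                ∎

    majorant : Carrier → ℕ → Carrier
    majorant C zero    = 1#
    majorant C (suc n) = majorant C n * (1# + C * ρ ^ n)

    module _ {C : Carrier} (0≤C : 0# ≤ C) where
      private
        -- The sum of all C ρʲ, so that K ρⁿ is the tail from n on, and `K≈` splits off its first
        -- term.
        K : Carrier
        K = C * 1/[1-ρ]

        K≈ : K ≈ C + K * ρ
        K≈ = begin-equality
          C * i                       ≈⟨ solve 3 (λ C ρ i → C :* i :=
               C :* ((:1 :- ρ) :* i) :+ C :* i :* ρ) refl C ρ i ⟩
          C * ((1# - ρ) * i) + K * ρ  ≈⟨ +-congʳ (trans (*-congˡ [1-ρ]*1/[1-ρ]≈1) (*-identityʳ C)) ⟩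
          C + K * ρ                   ∎
          where i = 1/[1-ρ]

      0≤majorant : ∀ n → 0# ≤ majorant C n
      0≤majorant zero    = 0≤1
      0≤majorant (suc n) = *-nonneg (0≤majorant n) (+-nonneg 0≤1 (*-nonneg 0≤C (0≤ρ^ n)))

      majorant-mono : ∀ m n → majorant C n ≤ majorant C (m ℕ.+ n)
      majorant-mono zero    n = ≤-refl
      majorant-mono (suc m) n = ≤-trans (majorant-mono m n) (begin
        majorant C (m ℕ.+ n)
          ≈⟨ *-identityʳ _ ⟨
        majorant C (m ℕ.+ n) * 1#
          ≤⟨ *-monoʳ-≤ (0≤majorant (m ℕ.+ n)) (x≤x+y (*-nonneg 0≤C (0≤ρ^ (m ℕ.+ n)))) ⟩
        majorant C (m ℕ.+ n) * (1# + C * ρ ^ (m ℕ.+ n)) ∎)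

      -- (1 - Kρⁿ)(1 + Cρⁿ) ≤ 1 - Kρⁿ⁺¹ because K - C = Kρ.
      majorant-growth : ∀ J m → (1# - K * ρ ^ J) * majorant C (m ℕ.+ J) ≤ majorant C J * (1# - K * ρ ^ (m ℕ.+ J))
      majorant-growth J zero    = ≤-reflexive (*-comm _ _)
      majorant-growth J (suc m) = begin
        (1# - K * ρ ^ J) * (majorant C n * (1# + C * ρ ^ n))
          ≈⟨ *-assoc _ _ _ ⟨
        (1# - K * ρ ^ J) * majorant C n * (1# + C * ρ ^ n)
          ≤⟨ *-monoˡ-≤ (+-nonneg 0≤1 (*-nonneg 0≤C (0≤ρ^ n))) (majorant-growth J m) ⟩
        majorant C J * (1# - K * ρ ^ n) * (1# + C * ρ ^ n)
          ≈⟨ *-assoc _ _ _ ⟩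
        majorant C J * ((1# - K * ρ ^ n) * (1# + C * ρ ^ n))
          ≤⟨ *-monoʳ-≤ (0≤majorant J) (0≤-⇒≤ step (*-nonneg (*-nonneg 0≤K (0≤ρ^ n)) (*-nonneg 0≤C (0≤ρ^ n)))) ⟩
        majorant C J * (1# - K * ρ ^ suc n) ∎
        where
        n = m ℕ.+ J
        0≤K : 0# ≤ K
        0≤K = *-nonneg 0≤C 0≤1/[1-ρ]
        step : (1# - K * ρ ^ n) * (1# + C * ρ ^ n) + K * ρ ^ n * (C * ρ ^ n) ≈ 1# - K * ρ ^ suc n
        step = begin-equality
          (1# - K * ρ ^ n) * (1# + C * ρ ^ n) + K * ρ ^ n * (C * ρ ^ n)
            ≈⟨ solve 3 (λ K C p → (:1 :- K :* p) :* (:1 :+ C :* p) :+ K :* p :* (C :* p) :=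
                 :1 :+ C :* p :- K :* p) refl K C (ρ ^ n) ⟩
          1# + C * ρ ^ n - K * ρ ^ n
            ≈⟨ +-congˡ (-‿cong (*-congʳ K≈)) ⟩
          1# + C * ρ ^ n - (C + K * ρ) * ρ ^ n
            ≈⟨ solve 4 (λ K C p ρ → :1 :+ C :* p :- (C :+ K :* ρ) :* p :=
                 :1 :- K :* (ρ :* p)) refl K C (ρ ^ n) ρ ⟩
          1# - K * ρ ^ suc n ∎

      abstract
        -- Takes the place of the bound exp(C/(1 - ρ)). Once K ρᴶ ≤ ½, `majorant-growth` bounds the
        -- product of the factors from J on by 1/(1 - K ρᴶ) ≤ 2; monotonicity then covers the
        -- indices below J.
        majorant-bounded : ∃[ M ] ∀ n → majorant C n ≤ M
        majorant-bounded =
          majorant C J * (1# + 1#) , λ n → (begin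
            majorant C n
              ≤⟨ majorant-mono J n ⟩
            majorant C (J ℕ.+ n)
              ≡⟨ ≡.cong (majorant C) (ℕ.+-comm J n) ⟩
            majorant C (n ℕ.+ J)
              ≈⟨ trans (sym (*-identityʳ _)) (*-congˡ (sym 2*½≈1)) ⟩
            majorant C (n ℕ.+ J) * ((1# + 1#) * ½)
              ≈⟨ solve 2 (λ M h → M :* ((:1 :+ :1) :* h) :=
                   h :* M :* (:1 :+ :1)) refl (majorant C (n ℕ.+ J)) ½ ⟩
            ½ * majorant C (n ℕ.+ J) * (1# + 1#)
              ≤⟨ *-monoˡ-≤ 0≤2 (*-monoˡ-≤ (0≤majorant (n ℕ.+ J)) (½≤ (proj₂ small J ℕ.≤-refl))) ⟩
            (1# - K * ρ ^ J) * majorant C (n ℕ.+ J) * (1# + 1#)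
              ≤⟨ *-monoˡ-≤ 0≤2 (majorant-growth J n) ⟩
            majorant C J * (1# - K * ρ ^ (n ℕ.+ J)) * (1# + 1#)
              ≤⟨ *-monoˡ-≤ 0≤2 (*-monoʳ-≤ (0≤majorant J) (0≤-⇒≤
                 (solve 1 (λ p → :1 :- p :+ p := :1) refl (K * ρ ^ (n ℕ.+ J)))
                   (*-nonneg (*-nonneg 0≤C 0≤1/[1-ρ]) (0≤ρ^ (n ℕ.+ J))))) ⟩
            majorant C J * 1# * (1# + 1#)
              ≈⟨ *-congʳ (*-identityʳ _) ⟩
            majorant C J * (1# + 1#) ∎)
          where
          small : ∃[ N ] ∀ n → N ℕ.≤ n → K * ρ ^ n ≤ ½
          small = K*ρ^n→0 K ½ 0<½
          J : ℕ
          J = proj₁ small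
          0≤2 : 0# ≤ 1# + 1#
          0≤2 = +-nonneg 0≤1 0≤1
          ½≤ : ∀ {x} → x ≤ ½ → ½ ≤ 1# - x
          ½≤ {x} x≤½ = 0≤-⇒≤ (begin-equality
            ½ + (½ - x)          ≈⟨ solve 2 (λ h x → h :+ (h :- x) := (:1 :+ :1) :* h :- x) refl ½ x ⟩
            (1# + 1#) * ½ - x    ≈⟨ +-congʳ 2*½≈1 ⟩
            1# - x               ∎) (≤⇒0≤- x≤½)

    -- The error bound passes to the limit because ≤ is a negation.
    geometric⇒limit : ∀ {K} → 0# ≤ K → ∀ s →
      (∀ m n → m ℕ.≤ n → s m ≤ s n + K * ρ ^ m) →
      (∀ m n → m ℕ.≤ n → s n ≤ s m + K * ρ ^ m) →
      ∃[ l ] ∀ m → s m ≤ l + K * ρ ^ m × l ≤ s m + K * ρ ^ m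
    geometric⇒limit {K} 0≤K s lower upper =
      l , λ m → below m , above m
      where
      cauchy : IsCauchy s
      cauchy ε 0<ε = N , λ m n N≤m N≤n → begin-strict
          s m                                  ≤⟨ upper N m N≤m ⟩
          s N + K * ρ ^ N                      ≤⟨ +-mono-≤ (lower N n N≤n) ≤-refl ⟩
          s n + K * ρ ^ N + K * ρ ^ N          ≤⟨ +-mono-≤ (+-monoʳ-≤ (s n) (proj₂ small N ℕ.≤-refl)) (proj₂ small N ℕ.≤-refl) ⟩
          s n + ε * ½ * ½ + ε * ½ * ½          ≈⟨ trans (+-assoc _ _ _) (+-congˡ (x*½+x*½≈x (ε * ½))) ⟩
          s n + ε * ½                          <⟨ +-monoʳ-< (s n) (x*½<x 0<ε) ⟩
          s n + ε                              ∎
        where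
        small : ∃[ N ] ∀ n → N ℕ.≤ n → K * ρ ^ n ≤ ε * ½ * ½
        -- Two errors of ε/4 add up to ε/2, which leaves room for the strict inequality.
        small = K*ρ^n→0 K (ε * ½ * ½) (0<x*½ (0<x*½ 0<ε))
        N = proj₁ small

      l : Carrier
      l = proj₁ (complete s cauchy)

      limit : IsLimit s l
      limit = proj₂ (complete s cauchy)

      -- A bound to be refuted provides its own ε, namely the width of the gap.
      near : ∀ {x y} → x < y → ∃[ N ] ∀ n → N ℕ.≤ n → s n < l + (y - x) × l < s n + (y - x)
      near x<y = limit _ (<⇒0<- x<y)

      below : ∀ m → s m ≤ l + K * ρ ^ m
      below m gap = lower m n (ℕ.m≤m+n m _) (begin-strict
        s n + K * ρ ^ m
          ≈⟨ +-comm _ _ ⟩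
        K * ρ ^ m + s n
          <⟨ +-monoʳ-< _ (proj₁ (proj₂ (near gap) n (ℕ.m≤n+m _ m))) ⟩
        K * ρ ^ m + (l + (s m - (l + K * ρ ^ m)))
          ≈⟨ solve 3 (λ k l s → k :+ (l :+ (s :- (l :+ k))) := s) refl (K * ρ ^ m) l (s m) ⟩
        s m ∎)
        where
        n = m ℕ.+ proj₁ (near gap)

      above : ∀ m → l ≤ s m + K * ρ ^ m
      above m gap = <-irrefl refl (begin-strict
        l
          <⟨ proj₂ (proj₂ (near gap) n (ℕ.m≤n+m _ m)) ⟩
        s n + (l - (s m + K * ρ ^ m))
          ≤⟨ +-monoˡ-≤ _ (upper m n (ℕ.m≤m+n m _)) ⟩
        s m + K * ρ ^ m + (l - (s m + K * ρ ^ m))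
          ≈⟨ solve 2 (λ u l → u :+ (l :- u) := l) refl (s m + K * ρ ^ m) l ⟩
        l ∎)
        where
        n = m ℕ.+ proj₁ (near gap)

-- Complete normed fields, described through upper bounds of the norm.

module Normed {c ℓ₁ ℓ₂} (ℝ : RealField c ℓ₁ ℓ₂) where
  module ℝ where
    open RealField ℝ public
    open RealProperties ℝ public

  -- z ≼ r stands for |z| ≤ r; the completeness axiom covers only sequences that
  -- converge geometrically.
  record CompleteNorm {a ℓ ℓ#} (F : HeytingField a ℓ ℓ#) : Set (a ⊔ ℓ ⊔ ℓ# ⊔ c ⊔ ℓ₁ ⊔ lsuc ℓ₂) where
    infix 4 _≼_
    open HeytingField F
    field
      _≼_      : Carrier → ℝ.Carrier → Set ℓ₂
      ≼⇒0≤     : ∀ {z r} → z ≼ r → ℝ.0# ℝ.≤ r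
      ≼-resp   : ∀ {z w r s} → z ≈ w → r ℝ.≤ s → z ≼ r → w ≼ s
      0≼0      : 0# ≼ ℝ.0#
      1≼1      : 1# ≼ ℝ.1#
      ≼-+      : ∀ {z w r s} → z ≼ r → w ≼ s → z + w ≼ r ℝ.+ s
      ≼-*      : ∀ {z w r s} → z ≼ r → w ≼ s → z * w ≼ r ℝ.* s
      ≼-neg    : ∀ {z r} → z ≼ r → - z ≼ r
      ≼-exists : ∀ z → ∃[ r ] z ≼ r
      ≼-inv    : ∀ {z d} → z ≼ ℝ.½ → (1# - z) * d ≈ 1# → d ≼ ℝ.1# ℝ.+ ℝ.1#
      ≼-limit  : ∀ {ρ K} → ℝ.0# ℝ.≤ ρ → ρ ℝ.< ℝ.1# → (s : ℕ → Carrier) →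
                 (∀ m n → m ℕ.≤ n → s n - s m ≼ K ℝ.* ρ ℝ.^ m) →
                 ∃[ l ] ∃[ K′ ] ∀ m → s m - l ≼ K′ ℝ.* ρ ℝ.^ m
      1-z#0    : ∀ {z r} → z ≼ r → r ℝ.< ℝ.1# → 1# - z # 0#

-- The complex numbers as a complete normed field.

module ComplexProperties {c ℓ₁ ℓ₂} (ℝ : RealField c ℓ₁ ℓ₂) where
  open RealField ℝ
  open RealProperties ℝ
  open Complex ℝ
  open IntegerRingSolver (RealProperties.commutativeRing ℝ)
  open ≤-Reasoning
  module ℂ = HeytingField complexField

  infix 4 _≼_
  _≼_ : ℂ → Carrier → Set ℓ₂
  z ≼ r = 0# ≤ r × normSq z ≤ r * r

  0≤normSq : ∀ z → 0# ≤ normSq z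
  0≤normSq (x , y) = +-nonneg (square-nonneg x) (square-nonneg y)

  normSq-cong : ∀ {z w} → z ℂ.≈ w → normSq z ≈ normSq w
  normSq-cong (x≈u , y≈v) = +-cong (*-cong x≈u x≈u) (*-cong y≈v y≈v)

  normSq-* : ∀ z w → normSq (z ℂ.* w) ≈ normSq z * normSq w
  normSq-* (x , y) (u , v) = solve 4 (λ x y u v →
    (x :* u :- y :* v) :* (x :* u :- y :* v) :+ (x :* v :+ y :* u) :* (x :* v :+ y :* u) :=
    (x :* x :+ y :* y) :* (u :* u :+ v :* v)) refl x y u v

  ≤-sum⇒≤ : ∀ {x y z} → 0# ≤ y → x + y ≤ z → x ≤ z
  ≤-sum⇒≤ 0≤y x+y≤z = ≤-trans (x≤x+y 0≤y) x+y≤z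

  square-mono-≤ : ∀ {x y} → 0# ≤ x → x ≤ y → x * x ≤ y * y
  square-mono-≤ 0≤x x≤y = *-mono-≤ 0≤x (≤-trans 0≤x x≤y) x≤y x≤y

  -‿square : ∀ x → - x * - x ≈ x * x
  -‿square x = solve 1 (λ x → :- x :* :- x := x :* x) refl x

  ≼⇒re≤ : ∀ {x y r} → (x , y) ≼ r → x ≤ r
  ≼⇒re≤ {y = y} (0≤r , N≤rr) = square-≤⇒≤ 0≤r (≤-sum⇒≤ (square-nonneg y) N≤rr)

  ≼⇒im≤ : ∀ {x y r} → (x , y) ≼ r → y ≤ r
  ≼⇒im≤ {x} (0≤r , N≤rr) =
    square-≤⇒≤ 0≤r (≤-sum⇒≤ (square-nonneg x) (≤-trans (≤-reflexive (+-comm _ _)) N≤rr))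

  ≼-neg : ∀ {z r} → z ≼ r → ℂ.- z ≼ r
  ≼-neg {x , y} (0≤r , N≤rr) = 0≤r , ≤-trans (≤-reflexive (+-cong (-‿square x) (-‿square y))) N≤rr

  ≼-resp : ∀ {z w r s} → z ℂ.≈ w → r ≤ s → z ≼ r → w ≼ s
  ≼-resp {z} {w} z≈w r≤s (0≤r , N≤rr) =
    ≤-trans 0≤r r≤s , ≤-trans (≤-reflexive (sym (normSq-cong {z} {w} z≈w))) (≤-trans N≤rr (square-mono-≤ 0≤r r≤s))

  ≼-* : ∀ {z w r s} → z ≼ r → w ≼ s → z ℂ.* w ≼ r * s
  ≼-* {z} {w} {r} {s} (0≤r , Nz≤rr) (0≤s , Nw≤ss) = *-nonneg 0≤r 0≤s , (begin
    normSq (z ℂ.* w)     ≈⟨ normSq-* z w ⟩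
    normSq z * normSq w  ≤⟨ *-mono-≤ (0≤normSq z) (square-nonneg s) Nz≤rr Nw≤ss ⟩
    r * r * (s * s)      ≈⟨ solve 2 (λ r s → r :* r :* (s :* s) := r :* s :* (r :* s)) refl r s ⟩
    r * s * (r * s)      ∎)

  inner : ℂ → ℂ → Carrier
  inner (x , y) (u , v) = x * u + y * v

  -- Lagrange's identity: the square of the inner product plus that of x v - y u is exactly
  -- |z|²|w|².
  cauchy-schwarz : ∀ {z w r s} → z ≼ r → w ≼ s → inner z w ≤ r * s
  cauchy-schwarz {z@(x , y)} {w@(u , v)} {r} {s} (0≤r , Nz≤rr) (0≤s , Nw≤ss) =
    square-≤⇒≤ (*-nonneg 0≤r 0≤s) (≤-sum⇒≤ (square-nonneg (x * v - y * u)) (begin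
      inner z w * inner z w + (x * v - y * u) * (x * v - y * u)
        ≈⟨ solve 4 (λ x y u v → (x :* u :+ y :* v) :* (x :* u :+ y :* v) :+ (x :* v :- y :* u) :* (x :* v :- y :* u) :=
             (x :* x :+ y :* y) :* (u :* u :+ v :* v)) refl x y u v ⟩
      normSq z * normSq w
        ≤⟨ *-mono-≤ (0≤normSq z) (square-nonneg s) Nz≤rr Nw≤ss ⟩
      r * r * (s * s)
        ≈⟨ solve 2 (λ r s → r :* r :* (s :* s) := r :* s :* (r :* s)) refl r s ⟩
      r * s * (r * s) ∎))

  ≼-+ : ∀ {z w r s} → z ≼ r → w ≼ s → z ℂ.+ w ≼ r + s
  ≼-+ {z@(x , y)} {w@(u , v)} {r} {s} z≼r w≼s = +-nonneg (proj₁ z≼r) (proj₁ w≼s) , (begin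
    normSq (z ℂ.+ w)
      ≈⟨ solve 4 (λ x y u v → (x :+ u) :* (x :+ u) :+ (y :+ v) :* (y :+ v) :=
           (x :* x :+ y :* y) :+ (u :* u :+ v :* v) :+ ((x :* u :+ y :* v) :+ (x :* u :+ y :* v))) refl x y u v ⟩
    normSq z + normSq w + (inner z w + inner z w)
      ≤⟨ +-mono-≤ (+-mono-≤ (proj₂ z≼r) (proj₂ w≼s)) (+-mono-≤ cs cs) ⟩
    r * r + s * s + (r * s + r * s)
      ≈⟨ solve 2 (λ r s → r :* r :+ s :* s :+ (r :* s :+ r :* s) := (r :+ s) :* (r :+ s)) refl r s ⟩
    (r + s) * (r + s) ∎)
    where
    cs : inner z w ≤ r * s
    cs = cauchy-schwarz z≼r w≼s

  -- The bound 1 + |z|² avoids a square root: (1 + N)² exceeds N by 1 + N + N².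
  ≼-exists : ∀ z → ∃[ r ] z ≼ r
  ≼-exists z = 1# + N , +-nonneg 0≤1 0≤N , 0≤-⇒≤ (solve 1 (λ N → N :+ (:1 :+ N :+ N :* N) :=
       (:1 :+ N) :* (:1 :+ N)) refl N)
    (+-nonneg (+-nonneg 0≤1 0≤N) (square-nonneg N))
    where
    N = normSq z
    0≤N : 0# ≤ N
    0≤N = 0≤normSq z

  square≤ : ∀ {x r} → x ≤ r → - x ≤ r → x * x ≤ r * r
  square≤ {x} {r} x≤r -x≤r = 0≤-⇒≤ (solve 2 (λ x r → x :* x :+ (r :- x) :* (r :- :- x) := r :* r) refl x r)
    (*-nonneg (≤⇒0≤- x≤r) (≤⇒0≤- -x≤r))

  -- Two upper bounds encode the absolute value of each coordinate, and 2 replaces √2.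
  coordinates⇒≼ : ∀ {x y r} → 0# ≤ r → x ≤ r → - x ≤ r → y ≤ r → - y ≤ r → (x , y) ≼ (1# + 1#) * r
  coordinates⇒≼ {x} {y} {r} 0≤r x≤r -x≤r y≤r -y≤r = *-nonneg (+-nonneg 0≤1 0≤1) 0≤r , (begin
    x * x + y * y                    ≤⟨ +-mono-≤ (square≤ x≤r -x≤r) (square≤ y≤r -y≤r) ⟩
    r * r + r * r                    ≤⟨ x≤x+y (+-nonneg (square-nonneg r) (square-nonneg r)) ⟩
    r * r + r * r + (r * r + r * r)  ≈⟨ solve 1 (λ r → r :* r :+ r :* r :+ (r :* r :+ r :* r) :=
         (:1 :+ :1) :* r :* ((:1 :+ :1) :* r)) refl r ⟩
    (1# + 1#) * r * ((1# + 1#) * r)  ∎)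

  -- The real part of 1 - z is at least ½, so |1 - z|² ≥ ¼, and multiplicativity of `normSq` gives
  -- |d|² ≤ 4.
  ≼-inv : ∀ {z d} → z ≼ ½ → (ℂ.1# ℂ.- z) ℂ.* d ℂ.≈ ℂ.1# → d ≼ 1# + 1#
  ≼-inv {z@(x , y)} {d} z≼½ eq = +-nonneg 0≤1 0≤1 , (begin
    normSq d
      ≈⟨ *-identityˡ _ ⟨
    1# * normSq d
      ≈⟨ *-congʳ (trans (*-cong 2*½≈1 2*½≈1) (*-identityˡ 1#)) ⟨
    (1# + 1#) * ½ * ((1# + 1#) * ½) * normSq d
      ≈⟨ solve 2 (λ h N → (:1 :+ :1) :* h :* ((:1 :+ :1) :* h) :* N :=
           (:1 :+ :1) :* (:1 :+ :1) :* (h :* h :* N)) refl ½ (normSq d) ⟩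
    (1# + 1#) * (1# + 1#) * (½ * ½ * normSq d)
      ≤⟨ *-monoʳ-≤ (square-nonneg _) (*-monoˡ-≤ (0≤normSq d) (≤-trans (square-mono-≤ (<⇒≤ 0<½) ½≤1-x) (x≤x+y (square-nonneg _)))) ⟩
    (1# + 1#) * (1# + 1#) * (normSq (ℂ.1# ℂ.- z) * normSq d)
      ≈⟨ *-congˡ (trans (sym (normSq-* (ℂ.1# ℂ.- z) d)) (normSq-cong {(ℂ.1# ℂ.- z) ℂ.* d} {ℂ.1#} eq)) ⟩
    (1# + 1#) * (1# + 1#) * (1# * 1# + 0# * 0#)
      ≈⟨ solve 0 ((:1 :+ :1) :* (:1 :+ :1) :* (:1 :* :1 :+ :0 :* :0) := (:1 :+ :1) :* (:1 :+ :1)) refl ⟩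
    (1# + 1#) * (1# + 1#) ∎)
    where
    ½≤1-x : ½ ≤ 1# - x
    ½≤1-x = 0≤-⇒≤ (begin-equality
      ½ + (½ - x)          ≈⟨ solve 2 (λ h x → h :+ (h :- x) := (:1 :+ :1) :* h :- x) refl ½ x ⟩
      (1# + 1#) * ½ - x    ≈⟨ +-congʳ 2*½≈1 ⟩
      1# - x               ∎) (≤⇒0≤- (≼⇒re≤ {x} {y} z≼½))

  x-y≤r⇒x≤y+r : ∀ {x y r} → x - y ≤ r → x ≤ y + r
  x-y≤r⇒x≤y+r {x} {y} {r} x-y≤r = begin
    x            ≈⟨ solve 2 (λ x y → x := y :+ (x :- y)) refl x y ⟩
    y + (x - y)  ≤⟨ +-monoʳ-≤ y x-y≤r ⟩
    y + r        ∎

  x≤y+r⇒x-y≤r : ∀ {x y r} → x ≤ y + r → x - y ≤ r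
  x≤y+r⇒x-y≤r {x} {y} {r} x≤y+r = begin
    x - y      ≤⟨ +-monoˡ-≤ (- y) x≤y+r ⟩
    y + r - y  ≈⟨ solve 2 (λ y r → y :+ r :- y := r) refl y r ⟩
    r          ∎

  -[x-y]≈y-x : ∀ x y → - (x - y) ≈ y - x
  -[x-y]≈y-x x y = solve 2 (λ x y → :- (x :- y) := y :- x) refl x y

  ≼-limit : ∀ {ρ K} → 0# ≤ ρ → ρ < 1# → ∀ s →
            (∀ m n → m ℕ.≤ n → s n ℂ.- s m ≼ K * ρ ^ m) →
            ∃[ l ] ∃[ K′ ] ∀ m → s m ℂ.- l ≼ K′ * ρ ^ m
  ≼-limit {ρ} {K} 0≤ρ ρ<1 s close = (proj₁ reLimit , proj₁ imLimit) , (1# + 1#) * K , λ m →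
    ≼-resp {s m ℂ.- l} {s m ℂ.- l} (refl , refl) (≤-reflexive (sym (*-assoc _ _ _))) (coordinates⇒≼ (*-nonneg 0≤K (0≤ρ^ m))
      (x≤y+r⇒x-y≤r (proj₁ (proj₂ reLimit m)))
      (≤-trans (≤-reflexive (-[x-y]≈y-x _ _)) (x≤y+r⇒x-y≤r (proj₂ (proj₂ reLimit m))))
      (x≤y+r⇒x-y≤r (proj₁ (proj₂ imLimit m)))
      (≤-trans (≤-reflexive (-[x-y]≈y-x _ _)) (x≤y+r⇒x-y≤r (proj₂ (proj₂ imLimit m)))))
    where
    open Geometric 0≤ρ ρ<1

    0≤K : 0# ≤ K
    0≤K = ≤-trans (proj₁ (close 0 0 ℕ.z≤n)) (≤-reflexive (*-identityʳ K))

    -- `≼⇒re≤` and `≼⇒im≤` bound coordinates from above only; the negated difference yields the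
    -- bounds from below.
    close′ : ∀ m n → m ℕ.≤ n → ℂ.- (s n ℂ.- s m) ≼ K * ρ ^ m
    close′ m n m≤n = ≼-neg {s n ℂ.- s m} (close m n m≤n)

    reLimit : ∃[ l ] ∀ m → proj₁ (s m) ≤ l + K * ρ ^ m × l ≤ proj₁ (s m) + K * ρ ^ m
    reLimit = geometric⇒limit 0≤K (proj₁ ∘ s)
      (λ m n m≤n → x-y≤r⇒x≤y+r (≤-trans (≤-reflexive (sym (-[x-y]≈y-x _ _))) (≼⇒re≤ (close′ m n m≤n))))
      (λ m n m≤n → x-y≤r⇒x≤y+r (≼⇒re≤ (close m n m≤n)))

    imLimit : ∃[ l ] ∀ m → proj₂ (s m) ≤ l + K * ρ ^ m × l ≤ proj₂ (s m) + K * ρ ^ m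
    imLimit = geometric⇒limit 0≤K (proj₂ ∘ s)
      (λ m n m≤n → x-y≤r⇒x≤y+r (≤-trans (≤-reflexive (sym (-[x-y]≈y-x _ _))) (≼⇒im≤ (close′ m n m≤n))))
      (λ m n m≤n → x-y≤r⇒x≤y+r (≼⇒im≤ (close m n m≤n)))

    l : ℂ
    l = proj₁ reLimit , proj₁ imLimit

  ≼<1⇒1-z#0 : ∀ {z r} → z ≼ r → r < 1# → ℂ.1# ℂ.- z ℂ.# ℂ.0#
  ≼<1⇒1-z#0 {x , y} z≼r r<1 = inj₁ (#-sym (<⇒# (<⇒0<- (≤-<-trans (≼⇒re≤ {x} {y} z≼r) r<1))))

  complexNorm : Normed.CompleteNorm ℝ complexField
  complexNorm = record
    { _≼_      = _≼_
    ; ≼⇒0≤     = proj₁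
    ; ≼-resp   = λ {z} {w} → ≼-resp {z} {w}
    ; 0≼0      = ≤-refl , ≤-reflexive (solve 0 (:0 :* :0 :+ :0 :* :0 := :0 :* :0) refl)
    ; 1≼1      = 0≤1 , ≤-reflexive (solve 0 (:1 :* :1 :+ :0 :* :0 := :1 :* :1) refl)
    ; ≼-+      = ≼-+
    ; ≼-*      = λ {z} {w} → ≼-* {z} {w}
    ; ≼-neg    = λ {z} → ≼-neg {z}
    ; ≼-exists = ≼-exists
    ; ≼-inv    = λ {z} {d} → ≼-inv {z} {d}
    ; ≼-limit  = ≼-limit
    ; 1-z#0    = λ {z} → ≼<1⇒1-z#0 {z}
    }

  ≼⇒∣∣< : ∀ {z r ε} → z ≼ r → r < ε → ∣ z ∣< ε
  ≼⇒∣∣< {z} {r} {ε} (0≤r , N≤rr) r<ε = 0<ε , ≤-<-trans N≤rr (0<-⇒<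
    (solve 2 (λ r ε → r :* r :+ (ε :- r) :* (ε :+ r) := ε :* ε) refl r ε)
    (*-positive (<⇒0<- r<ε) (<-≤-trans 0<ε (x≤x+y 0≤r))))
    where
    0<ε : 0# < ε
    0<ε = ≤-<-trans 0≤r r<ε

  -- By AM-GM, ρ = (1 + |z|²)/2 is a bound for |z|.
  ∣∣<1⇒≼ : ∀ {z} → ∣ z ∣< 1# → ∃[ ρ ] ρ < 1# × z ≼ ρ
  ∣∣<1⇒≼ {z} (_ , N<1*1) = ρ , ρ<1 , 0≤ρ , 0≤-⇒≤ (begin-equality
    N + (½ - N * ½) * (½ - N * ½)
      ≈⟨ +-congʳ (trans (*-congˡ (trans (*-cong 2*½≈1 2*½≈1) (*-identityˡ 1#))) (*-identityʳ N)) ⟨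
    N * ((1# + 1#) * ½ * ((1# + 1#) * ½)) + (½ - N * ½) * (½ - N * ½)
      ≈⟨ solve 2 (λ N h → N :* ((:1 :+ :1) :* h :* ((:1 :+ :1) :* h)) :+ (h :- N :* h) :* (h :- N :* h) :=
           (:1 :+ N) :* h :* ((:1 :+ N) :* h)) refl N ½ ⟩
    ρ * ρ ∎) (square-nonneg _)
    where
    N = normSq z
    ρ = (1# + N) * ½

    0≤ρ : 0# ≤ ρ
    0≤ρ = *-nonneg (+-nonneg 0≤1 (0≤normSq z)) (<⇒≤ 0<½)

    ρ<1 : ρ < 1#
    ρ<1 = 0<-⇒< (begin-equality
      (1# + N) * ½ + (1# * 1# - N) * ½  ≈⟨ solve 2 (λ N h → (:1 :+ N) :* h :+ (:1 :* :1 :- N) :* h :=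
           (:1 :+ :1) :* h) refl N ½ ⟩
      (1# + 1#) * ½                     ≈⟨ 2*½≈1 ⟩
      1#                                ∎) (0<x*½ (<⇒0<- N<1*1))

-- Finite sums and products.

module FiniteOperations {c ℓ} (R : CommutativeRing c ℓ) where
  open CommutativeRing R
  open RawSemiringDefinitions (Semiring.rawSemiring semiring) using (_^_)
  open IntegerRingSolver R

  -- These recurse at the last term, which suits induction on the length, whereas `sum` and
  -- `product` recurse at the first; `∑-head` and `∏-head` mediate.
  ∑ ∏ : (ℕ → Carrier) → ℕ → Carrier
  ∑ f zero    = 0#
  ∑ f (suc n) = ∑ f n + f n
  ∏ f zero    = 1#
  ∏ f (suc n) = ∏ f n * f n

  ∏-cong : ∀ {f g} → (∀ j → f j ≈ g j) → ∀ n → ∏ f n ≈ ∏ g n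
  ∏-cong f≈g zero    = refl
  ∏-cong f≈g (suc n) = *-cong (∏-cong f≈g n) (f≈g n)

  ∑-cong : ∀ {f g} → (∀ j → f j ≈ g j) → ∀ n → ∑ f n ≈ ∑ g n
  ∑-cong f≈g zero    = refl
  ∑-cong f≈g (suc n) = +-cong (∑-cong f≈g n) (f≈g n)

  ∏-* : ∀ f g n → ∏ (λ j → f j * g j) n ≈ ∏ f n * ∏ g n
  ∏-* f g zero    = sym (*-identityˡ 1#)
  ∏-* f g (suc n) = trans (*-congʳ (∏-* f g n))
    (solve 4 (λ F G x y → F :* G :* (x :* y) := F :* x :* (G :* y)) refl (∏ f n) (∏ g n) (f n) (g n))

  ∏-scale : ∀ x f n → ∏ (λ j → x * f j) n ≈ x ^ n * ∏ f n
  ∏-scale x f zero    = sym (*-identityˡ 1#)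
  ∏-scale x f (suc n) = trans (*-congʳ (∏-scale x f n))
    (solve 4 (λ p F x y → p :* F :* (x :* y) := x :* p :* (F :* y)) refl (x ^ n) (∏ f n) x (f n))

  ∏-1 : ∀ n → ∏ (λ _ → 1#) n ≈ 1#
  ∏-1 zero    = refl
  ∏-1 (suc n) = trans (*-identityʳ _) (∏-1 n)

  ∏-head : ∀ f n → ∏ f (suc n) ≈ f 0 * ∏ (f ∘ suc) n
  ∏-head f zero    = *-comm 1# (f 0)
  ∏-head f (suc n) = trans (*-congʳ (∏-head f n)) (*-assoc _ _ _)

  ∑-head : ∀ f n → ∑ f (suc n) ≈ f 0 + ∑ (f ∘ suc) n
  ∑-head f zero    = +-comm 0# (f 0)
  ∑-head f (suc n) = trans (+-congʳ (∑-head f n)) (+-assoc _ _ _)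

  ∏-inverse : ∀ {f g} → (∀ j → f j * g j ≈ 1#) → ∀ n → ∏ f n * ∏ g n ≈ 1#
  ∏-inverse {f} {g} fg≈1 n = trans (sym (∏-* f g n)) (trans (∏-cong fg≈1 n) (∏-1 n))

-- Calculus of bounds O(ρⁿ), limits and infinite products.

module Asymptotics {c ℓ₁ ℓ₂} (ℝ : RealField c ℓ₁ ℓ₂)
  {a ℓ ℓ#} (F : HeytingField a ℓ ℓ#) (∣F∣ : Normed.CompleteNorm ℝ F) {ρ : RealField.Carrier ℝ}
  (0≤ρ : RealProperties._≤_ ℝ (RealField.0# ℝ) ρ) (ρ<1 : RealField._<_ ℝ ρ (RealField.1# ℝ)) where

  open Normed ℝ using (module ℝ)
  open HeytingField F
  open Normed.CompleteNorm ∣F∣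
  open HeytingFieldOperations F using (_^_)
  open InvertibleElements F using (commutativeRing)
  open ℝ.Geometric 0≤ρ ρ<1
  open FiniteOperations commutativeRing
  private
    module ℝS = IntegerRingSolver ℝ.commutativeRing
    open IntegerRingSolver commutativeRing
    open ℝ.≤-Reasoning

    variable
      i : Level
      I J : Set i
      s t : I → Carrier
      d e : I → ℕ

  -- The index set is arbitrary and the constant is common to all of it: with pairs as indices this
  -- expresses uniformity in both parameters, and precomposition restricts to a diagonal.
  record O {I : Set i} (e : I → ℕ) (s : I → Carrier) : Set (i ⊔ c ⊔ ℓ₂) where
    constructor mkO
    field
      constant : ℝ.Carrier
      0≤constant : ℝ.0# ℝ.≤ constant
      bound : ∀ i → s i ≼ constant ℝ.* ρ ℝ.^ e i

  Bounded : (I → Carrier) → Set _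
  Bounded = O (λ _ → 0)

  O-resp : (∀ i → s i ≈ t i) → O e s → O e t
  O-resp s≈t (mkO M 0≤M s≼) = mkO M 0≤M λ i → ≼-resp (s≈t i) ℝ.≤-refl (s≼ i)

  ρ^-antitone : ∀ {m n} → m ℕ.≤ n → ρ ℝ.^ n ℝ.≤ ρ ℝ.^ m
  ρ^-antitone {m} {n} m≤n = ≡.subst (λ k → ρ ℝ.^ k ℝ.≤ ρ ℝ.^ m) (ℕ.m∸n+n≡m m≤n) (ρ^m+n≤ρ^n (n ℕ.∸ m) m)

  O-weaken : (∀ i → d i ℕ.≤ e i) → O e s → O d s
  O-weaken d≤e (mkO M 0≤M s≼) = mkO M 0≤M λ i → ≼-resp refl (ℝ.*-monoʳ-≤ 0≤M (ρ^-antitone (d≤e i))) (s≼ i)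

  O⇒Bounded : O e s → Bounded s
  O⇒Bounded = O-weaken (λ _ → ℕ.z≤n)

  O-∘ : (f : J → I) → O e s → O (e ∘ f) (s ∘ f)
  O-∘ f (mkO M 0≤M s≼) = mkO M 0≤M (s≼ ∘ f)

  O-const : ∀ z → Bounded {I = I} (λ _ → z)
  O-const z = mkO (proj₁ (≼-exists z)) (≼⇒0≤ (proj₂ (≼-exists z)))
    λ _ → ≼-resp refl (ℝ.≤-reflexive (ℝ.sym (ℝ.*-identityʳ _))) (proj₂ (≼-exists z))

  O-+ : O e s → O e t → O e (λ i → s i + t i)
  O-+ (mkO M 0≤M s≼) (mkO N 0≤N t≼) = mkO (M ℝ.+ N) (ℝ.+-nonneg 0≤M 0≤N)
    λ i → ≼-resp refl (ℝ.≤-reflexive (ℝ.sym (ℝ.distribʳ _ _ _))) (≼-+ (s≼ i) (t≼ i))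

  O-neg : O e s → O e (λ i → - s i)
  O-neg (mkO M 0≤M s≼) = mkO M 0≤M (≼-neg ∘ s≼)

  O-- : O e s → O e t → O e (λ i → s i - t i)
  O-- s t = O-+ s (O-neg t)

  O-* : O d s → O e t → O (λ i → d i ℕ.+ e i) (λ i → s i * t i)
  O-* {d = d} {e = e} (mkO M 0≤M s≼) (mkO N 0≤N t≼) = mkO (M ℝ.* N) (ℝ.*-nonneg 0≤M 0≤N)
    λ i → ≼-resp refl (ℝ.≤-reflexive (regroup i)) (≼-* (s≼ i) (t≼ i))
    where
    open ℝS renaming (solve to solveℝ; _:*_ to _⊗_; _:=_ to _⊜_)
    regroup : ∀ i → M ℝ.* ρ ℝ.^ d i ℝ.* (N ℝ.* ρ ℝ.^ e i) ℝ.≈ M ℝ.* N ℝ.* ρ ℝ.^ (d i ℕ.+ e i)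
    regroup i = ℝ.trans
      (solveℝ 4 (λ M p N r → M ⊗ p ⊗ (N ⊗ r) ⊜ M ⊗ N ⊗ (p ⊗ r)) ℝ.refl M (ρ ℝ.^ d i) N (ρ ℝ.^ e i))
      (ℝ.*-congˡ (ℝ.sym (ℝ.^-homo-* ρ (d i) (e i))))

  O-^ : ∀ {q} → q ≼ ρ → O id (q ^_)
  O-^ {q} q≼ρ = mkO ℝ.1# ℝ.0≤1 λ n → ≼-resp refl (ℝ.≤-reflexive (ℝ.sym (ℝ.*-identityˡ _))) (power n)
    where
    power : ∀ n → q ^ n ≼ ρ ℝ.^ n
    power zero    = 1≼1
    power (suc n) = ≼-* q≼ρ (power n)

  -- The geometric series costs a factor 1/(1 - ρ) whatever the number of terms, so the bound is
  -- uniform in the length.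
  O-∑ : {e : I → ℕ} {s : I → ℕ → Carrier} → O {I = I × ℕ} (λ (i , j) → e i ℕ.+ j) (λ (i , j) → s i j) →
        O {I = I × ℕ} (λ (i , n) → e i) (λ (i , n) → ∑ (s i) n)
  O-∑ {e = e} {s = s} (mkO M 0≤M s≼) = mkO (M ℝ.* 1/[1-ρ]) (ℝ.*-nonneg 0≤M 0≤1/[1-ρ]) λ (i , n) →
    ≼-resp refl (begin
      M ℝ.* ρ ℝ.^ e i ℝ.* geometricSum n
        ≤⟨ ℝ.*-monoʳ-≤ (ℝ.*-nonneg 0≤M (0≤ρ^ (e i))) (geometricSum≤ n) ⟩
      M ℝ.* ρ ℝ.^ e i ℝ.* 1/[1-ρ]
        ≈⟨ solveℝ 3 (λ M p c → M ⊗ p ⊗ c ⊜ M ⊗ c ⊗ p) ℝ.refl M (ρ ℝ.^ e i) 1/[1-ρ] ⟩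
      M ℝ.* 1/[1-ρ] ℝ.* ρ ℝ.^ e i ∎) (bound i n)
    where
    open ℝS renaming (solve to solveℝ; _:*_ to _⊗_; _:+_ to _⊕_; _:=_ to _⊜_)
    bound : ∀ i n → ∑ (s i) n ≼ M ℝ.* ρ ℝ.^ e i ℝ.* geometricSum n
    bound i zero    = ≼-resp refl (ℝ.≤-reflexive (ℝ.sym (ℝ.zeroʳ _))) 0≼0
    bound i (suc n) = ≼-resp refl (ℝ.≤-reflexive (ℝ.trans
      (ℝ.+-congˡ (ℝ.trans (ℝ.*-congˡ (ℝ.^-homo-* ρ (e i) n)) (ℝ.sym (ℝ.*-assoc _ _ _))))
      (ℝ.sym (ℝ.distribˡ _ _ _)))) (≼-+ (bound i n) (s≼ (i , n)))

  majorised⇒∏-Bounded : ∀ {C} → ℝ.0# ℝ.≤ C → (s : I → ℕ → Carrier) →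
    (∀ i j → s i j ≼ ℝ.1# ℝ.+ C ℝ.* ρ ℝ.^ j) → Bounded {I = I × ℕ} (λ (i , n) → ∏ (s i) n)
  majorised⇒∏-Bounded {C = C} 0≤C s s≼ =
    mkO M (ℝ.≤-trans ℝ.0≤1 (proj₂ (majorant-bounded 0≤C) 0)) λ (i , n) →
    ≼-resp refl (ℝ.≤-trans (proj₂ (majorant-bounded 0≤C) n) (ℝ.≤-reflexive (ℝ.sym (ℝ.*-identityʳ M)))) (bound i n)
    where
    M = proj₁ (majorant-bounded 0≤C)
    bound : ∀ i n → ∏ (s i) n ≼ majorant C n
    bound i zero    = 1≼1
    bound i (suc n) = ≼-* (bound i n) (s≼ i n)

  -- Factors of size C ρʲ are in particular at most 1 + C ρʲ, so the same majorant serves here.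
  O-∏ : {s : I → ℕ → Carrier} → O {I = I × ℕ} proj₂ (λ (i , j) → s i j) →
    Bounded {I = I × ℕ} (λ (i , n) → ∏ (s i) n)
  O-∏ {s = s} (mkO C 0≤C s≼) = majorised⇒∏-Bounded 0≤C s
    (λ i j → ≼-resp refl (ℝ.≤-trans (ℝ.x≤x+y ℝ.0≤1) (ℝ.≤-reflexive (ℝ.+-comm _ _))) (s≼ (i , j)))

  O-∏-1+ : {s : I → ℕ → Carrier} → O {I = I × ℕ} proj₂ (λ (i , j) → s i j) →
    Bounded {I = I × ℕ} (λ (i , n) → ∏ (λ j → 1# + s i j) n)
  O-∏-1+ {s = s} (mkO C 0≤C s≼) = majorised⇒∏-Bounded 0≤C (λ i j → 1# + s i j)
    (λ i j → ≼-+ 1≼1 (s≼ (i , j)))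

  -- The finitely many exceptions are absorbed one at a time by adding their bounds, which avoids
  -- maxima.
  eventuallyBounded⇒Bounded : ∀ {M} N (s : ℕ → Carrier) → ℝ.0# ℝ.≤ M → (∀ n → N ℕ.≤ n → s n ≼ M) → Bounded s
  eventuallyBounded⇒Bounded {M} zero s 0≤M s≼ =
    mkO M 0≤M λ n → ≼-resp refl (ℝ.≤-reflexive (ℝ.sym (ℝ.*-identityʳ M))) (s≼ n ℕ.z≤n)
  eventuallyBounded⇒Bounded (suc N) s 0≤M s≼ =
    mkO (K ℝ.+ r) (ℝ.+-nonneg (O.0≤constant tail) 0≤r) λ where
      zero    → ≼-resp refl (ℝ.≤-trans (ℝ.x≤x+y (O.0≤constant tail))
                  (ℝ.≤-reflexive (ℝ.trans (ℝ.+-comm _ _) (ℝ.sym (ℝ.*-identityʳ _)))))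
                  (proj₂ (≼-exists (s 0)))
      (suc n) → ≼-resp refl (ℝ.*-monoˡ-≤ ℝ.0≤1 (ℝ.x≤x+y 0≤r)) (O.bound tail n)
    where
    tail : Bounded (s ∘ suc)
    tail = eventuallyBounded⇒Bounded N (s ∘ suc) 0≤M (λ n N≤n → s≼ (suc n) (ℕ.s≤s N≤n))
    K = O.constant tail
    r = proj₁ (≼-exists (s 0))
    0≤r : ℝ.0# ℝ.≤ r
    0≤r = ≼⇒0≤ (proj₂ (≼-exists (s 0)))

  O⇒eventually≼ : O id s → ∀ ε → ℝ.0# ℝ.< ε → ∃[ N ] ∀ n → N ℕ.≤ n → s n ≼ ε
  O⇒eventually≼ (mkO M 0≤M s≼) ε 0<ε = proj₁ small , λ n N≤n → ≼-resp refl (proj₂ small n N≤n) (s≼ n)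
    where
    small : ∃[ N ] ∀ n → N ℕ.≤ n → M ℝ.* ρ ℝ.^ n ℝ.≤ ε
    small = K*ρ^n→0 M ε 0<ε

  -- Once |sⱼ| ≤ ½ the inverse is bounded by 2. The earlier ones may be large, but they are finitely
  -- many.
  inverse-Bounded : O id s → (∀ j → (1# - s j) * t j ≈ 1#) → Bounded t
  inverse-Bounded {s = s} {t = t} s=O [1-s]t≈1 =
    eventuallyBounded⇒Bounded (proj₁ small) t (ℝ.+-nonneg ℝ.0≤1 ℝ.0≤1)
      (λ n N≤n → ≼-inv (proj₂ small n N≤n) ([1-s]t≈1 n))
    where
    small : ∃[ N ] ∀ n → N ℕ.≤ n → s n ≼ ℝ.½
    small = O⇒eventually≼ s=O ℝ.½ ℝ.0<½

  infix 4 _⇝_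
  _⇝_ : (ℕ → Carrier) → Carrier → Set _
  s ⇝ l = O id (λ n → s n - l)

  ⇝-resp : (∀ n → s n ≈ t n) → ∀ {l} → s ⇝ l → t ⇝ l
  ⇝-resp s≈t = O-resp (λ n → +-congʳ (s≈t n))

  ⇝⇒Bounded : ∀ {l} → s ⇝ l → Bounded s
  ⇝⇒Bounded {s = s} {l} s⇝l = O-resp (λ n → solve 2 (λ s l → s :- l :+ l := s) refl (s n) l)
    (O-+ (O⇒Bounded s⇝l) (O-const l))

  ⇝-* : ∀ {k l} → s ⇝ k → t ⇝ l → (λ n → s n * t n) ⇝ k * l
  ⇝-* {s = s} {t = t} {k} {l} s⇝k t⇝l = O-resp
    (λ n → solve 4 (λ s k t l → s :* (t :- l) :+ l :* (s :- k) := s :* t :- k :* l) refl (s n) k (t n) l)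
    (O-+ (O-* (⇝⇒Bounded s⇝k) t⇝l) (O-* (O-const l) s⇝k))

  -- Consecutive partial products differ by Pⱼ sⱼ, and the Pⱼ are bounded, so the differences sum
  -- geometrically.
  ∏-converges : O id s → ∃[ P ] ∏ (λ j → 1# + s j) ⇝ P
  ∏-converges {s = s} s=O = proj₁ limit ,
    mkO (proj₁ (proj₂ limit)) 0≤K′ (proj₂ (proj₂ limit))
    where
    P : ℕ → Carrier
    P = ∏ (λ j → 1# + s j)

    P-Bounded : Bounded P
    P-Bounded = O-∘ (λ n → 0 , n) (O-∏-1+ {I = ℕ} {s = λ _ → s} (O-∘ proj₂ s=O))

    increment : ℕ → ℕ → Carrier
    increment m k = P (k ℕ.+ m) * s (k ℕ.+ m)

    telescope : ∀ m k → ∑ (increment m) k ≈ P (k ℕ.+ m) - P m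
    telescope m zero    = sym (-‿inverseʳ _)
    telescope m (suc k) = trans (+-congʳ (telescope m k))
      (solve 3 (λ p p₀ w → p :- p₀ :+ p :* w :=
           p :* (:1 :+ w) :- p₀) refl (P (k ℕ.+ m)) (P m) (s (k ℕ.+ m)))

    differences : O {I = ℕ × ℕ} (λ (m , k) → m) (λ (m , k) → P (k ℕ.+ m) - P m)
    differences = O-resp (λ (m , k) → telescope m k)
      (O-∑ {s = increment} (O-weaken (λ (m , k) → ℕ.≤-reflexive (ℕ.+-comm m k))
        (O-∘ {J = ℕ × ℕ} (λ (m , k) → k ℕ.+ m) (O-* P-Bounded s=O))))

    limit : ∃[ l ] ∃[ K′ ] ∀ m → P m - l ≼ K′ ℝ.* ρ ℝ.^ m
    limit = ≼-limit 0≤ρ ρ<1 P λ m n m≤n →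
      ≡.subst (λ n → P n - P m ≼ _) (ℕ.m∸n+n≡m m≤n) (O.bound differences (m , n ℕ.∸ m))

    0≤K′ : ℝ.0# ℝ.≤ proj₁ (proj₂ limit)
    0≤K′ = ℝ.≤-trans (≼⇒0≤ (proj₂ (proj₂ limit) 0)) (ℝ.≤-reflexive (ℝ.*-identityʳ _))

-- The telescoping recurrence and its iteration.

-- y stands for q/b, e for the inverses of 1 - a²qʲ⁺¹/b and g for those of 1 - qʲ⁺¹, so that
-- the recurrence is an identity in a commutative ring.
module Recurrence {c ℓ} (R : CommutativeRing c ℓ)
  (b q y : CommutativeRing.Carrier R) (g : ℕ → CommutativeRing.Carrier R) where
  open CommutativeRing R
  open RawSemiringDefinitions (Semiring.rawSemiring semiring) using (_^_)
  open FiniteOperations R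
  open IntegerRingSolver R
  open SetoidReasoning setoid

  factor : Carrier → (ℕ → Carrier) → Carrier
  factor a e = (1# + a) * (1# - a * a * q) * (1# - a * y) * (e 0 * e 1)

  -- With y = q/b the second product is (-a/b)ʳ q^(r(r+1)/2); in this form every factor displays its
  -- decay.
  numerator : Carrier → ℕ → Carrier
  numerator a r = ∏ (λ j → 1# - b * q ^ j) r * ∏ (λ j → - (a * y * q ^ j)) r

  summand : Carrier → (ℕ → Carrier) → ℕ → Carrier
  summand a e r = (1# + a * q ^ r) * ∏ (λ j → 1# - a * a * q ^ j) r * numerator a r * ∏ e r * ∏ g r

  -- The polynomial of degree one in Q that telescopes the difference between the summands for
  -- a and aq (found by comparing the constant and leading coefficients in certificate-identity).
  certificate : Carrier → Carrier → Carrier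
  certificate a Q = a * a * (1# - a * y) * Q - (1# - a)

  -- This is Gᵣ₊₁, while G₀ = 0, so a partial sum up to index n leaves only `remainder a e n`.
  -- Starting from (1 + a)(a²q;q)ᵣ rather than from (a²;q)ᵣ₊₁ divided by 1 - a keeps the case a = 1.
  remainder : Carrier → (ℕ → Carrier) → ℕ → Carrier
  remainder a e r = (1# + a) * ∏ (λ j → 1# - a * a * q * q ^ j) r * numerator a (suc r)
                  * certificate a (q ^ suc r) * ∏ e (suc (suc r)) * ∏ g r

  -- Replacing a by aq multiplies a²q/b by q², which moves its inverses by two places.
  shift : (ℕ → Carrier) → ℕ → Carrier
  shift e = e ∘ suc ∘ suc

  module _ (by≈q : b * y ≈ q) (g-inverse : ∀ j → (1# - q * q ^ j) * g j ≈ 1#) where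

    -- The telescoping relation at index r + 1 with Q = qʳ⁺¹, after removing the common factor `W`.
    -- As b occurs only in (1 - bQ)y = y - qQ, the solver proves the identity without b, and b y = q
    -- is substituted afterwards.
    certificate-identity : ∀ a Q →
      (1# + a * Q) * (1# - a) * (1# - a * a * y * Q) * (1# - a * a * y * (q * Q))
      ≈ (1# - a * y) * (1# + a * q * Q) * (1# - a * a * Q) * (1# - a * a * q * Q) * Q
        + ((1# - a * a * Q) * (1# - b * Q) * - (a * y * Q) * certificate a (q * Q)
           - (1# - Q) * (1# - a * a * y * (q * Q)) * certificate a Q)
    certificate-identity a Q = trans
      (solve 4 (λ a q Q y →
         (:1 :+ a :* Q) :* (:1 :- a) :* (:1 :- a :* a :* y :* Q) :* (:1 :- a :* a :* y :* (q :* Q)) :=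
         (:1 :- a :* y) :* (:1 :+ a :* q :* Q) :* (:1 :- a :* a :* Q) :* (:1 :- a :* a :* q :* Q) :* Q
         :+ (:- (a :* Q :* (:1 :- a :* a :* Q) :* (a :* a :* (:1 :- a :* y) :* (q :* Q) :- (:1 :- a))) :* (y :- q :* Q)
             :- (:1 :- Q) :* (:1 :- a :* a :* y :* (q :* Q)) :* (a :* a :* (:1 :- a :* y) :* Q :- (:1 :- a))))
         refl a q Q y)
      (+-congˡ (+-congʳ (trans (*-congˡ (+-congˡ (-‿cong (*-congʳ (sym by≈q)))))
        (solve 5 (λ a b Q y z →
           :- (a :* Q :* (:1 :- a :* a :* Q) :* z) :* (y :- b :* y :* Q) :=
           (:1 :- a :* a :* Q) :* (:1 :- b :* Q) :* :- (a :* y :* Q) :* z)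
           refl a b Q y (certificate a (q * Q))))))

    -- This is `certificate-identity` at Q = 1, where the last term vanishes, with the factor 1 - a²
    -- removed; as 1 - a² may be zero, it needs its own proof.
    certificate-identity₀ : ∀ a →
      (1# - a * a * y) * (1# - a * a * y * q)
      ≈ (1# - a * a * q) * (1# - a * y) * (1# + a * q) + (1# - b) * - (a * y) * certificate a q
    certificate-identity₀ a = trans
      (solve 3 (λ a q y →
         (:1 :- a :* a :* y) :* (:1 :- a :* a :* y :* q) :=
         (:1 :- a :* a :* q) :* (:1 :- a :* y) :* (:1 :+ a :* q)
         :+ :- (a :* (a :* a :* (:1 :- a :* y) :* q :- (:1 :- a))) :* (y :- q)) refl a q y)
      (+-congˡ (trans (*-congˡ (+-congˡ (-‿cong (sym by≈q))))
        (solve 4 (λ a b y z → :- (a :* z) :* (y :- b :* y) :=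
             (:1 :- b) :* :- (a :* y) :* z) refl a b y (certificate a q))))

    module _ (a : Carrier) (e : ℕ → Carrier) (e-inverse : ∀ j → (1# - a * a * y * q ^ j) * e j ≈ 1#) where

      summand₀ : summand a e 0 ≈ factor a e * summand (a * q) (shift e) 0 + remainder a e 0
      summand₀ = begin
        (1# + a * 1#) * 1# * (1# * 1#) * 1# * 1#
          ≈⟨ solve 1 (λ a → (:1 :+ a :* :1) :* :1 :* (:1 :* :1) :* :1 :* :1 :=
               (:1 :+ a) :* (:1 :* :1)) refl a ⟩
        (1# + a) * (1# * 1#)
          ≈⟨ *-congˡ (*-cong (e-inverse 0) (e-inverse 1)) ⟨
        (1# + a) * ((1# - a * a * y * 1#) * e 0 * ((1# - a * a * y * (q * 1#)) * e 1))
          ≈⟨ solve 5 (λ a q y e₀ e₁ →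
               (:1 :+ a) :* ((:1 :- a :* a :* y :* :1) :* e₀ :* ((:1 :- a :* a :* y :* (q :* :1)) :* e₁)) :=
               (:1 :+ a) :* (e₀ :* e₁) :* ((:1 :- a :* a :* y) :* (:1 :- a :* a :* y :* q))) refl a q y (e 0) (e 1) ⟩
        (1# + a) * (e 0 * e 1) * ((1# - a * a * y) * (1# - a * a * y * q))
          ≈⟨ *-congˡ (certificate-identity₀ a) ⟩
        (1# + a) * (e 0 * e 1) * ((1# - a * a * q) * (1# - a * y) * (1# + a * q) + (1# - b) * - (a * y) * certificate a q)
          ≈⟨ solve 6 (λ a b q y e₀ e₁ →
               (:1 :+ a) :* (e₀ :* e₁) :* ((:1 :- a :* a :* q) :* (:1 :- a :* y) :* (:1 :+ a :* q)
                 :+ (:1 :- b) :* :- (a :* y) :* (a :* a :* (:1 :- a :* y) :* q :- (:1 :- a))) :=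
               (:1 :+ a) :* (:1 :- a :* a :* q) :* (:1 :- a :* y) :* (e₀ :* e₁) :* ((:1 :+ a :* q :* :1) :* :1 :* (:1 :* :1) :* :1 :* :1)
               :+ (:1 :+ a) :* :1 :* (:1 :* (:1 :- b :* :1) :* (:1 :* :- (a :* y :* :1)))
                  :* (a :* a :* (:1 :- a :* y) :* (q :* :1) :- (:1 :- a)) :* (:1 :* e₀ :* e₁) :* :1) refl a b q y (e 0) (e 1) ⟩
        factor a e * summand (a * q) (shift e) 0 + remainder a e 0 ∎

      module _ (r : ℕ) where
        private
          Q = q ^ suc r
          A = ∏ (λ j → 1# - a * a * q * q ^ j) r
          B = ∏ (λ j → 1# - b * q ^ j) (suc r)
          U = ∏ (λ j → - (a * y * q ^ j)) (suc r)
          E = ∏ e (suc r)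
          G = ∏ g r
          e₁ = e (suc r)
          e₂ = e (suc (suc r))

          -- Carries every inverse that occurs in any of the four terms; a term that lacks one
          -- acquires it as a factor 1. Of (a²;q)ᵣ₊₁ it takes 1 + a and `A` only, so 1 - a is never
          -- cancelled.
          W : Carrier
          W = (1# + a) * A * B * U * (E * e₁ * e₂) * (G * g r)

          W-summand : summand a e (suc r) ≈
            W * ((1# + a * Q) * (1# - a) * (1# - a * a * y * Q) * (1# - a * a * y * (q * Q)))
          W-summand = begin
            (1# + a * Q) * ∏ (λ j → 1# - a * a * q ^ j) (suc r) * (B * U) * E * (G * g r)
              ≈⟨ *-congʳ (*-cong (*-congʳ (*-congˡ head)) E≈) ⟩
            (1# + a * Q) * ((1# - a * a) * A) * (B * U)
              * (E * ((1# - a * a * y * Q) * e₁ * ((1# - a * a * y * (q * Q)) * e₂))) * (G * g r)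
              ≈⟨ regroup A B U E G (g r) e₁ e₂ (1# - a * a * y * Q) (1# - a * a * y * (q * Q)) ⟩
            W * ((1# + a * Q) * (1# - a) * (1# - a * a * y * Q) * (1# - a * a * y * (q * Q))) ∎
            where
            head : ∏ (λ j → 1# - a * a * q ^ j) (suc r) ≈ (1# - a * a) * A
            head = trans (∏-head _ r) (*-cong
              (+-congˡ (-‿cong (*-identityʳ _)))
              (∏-cong (λ j → +-congˡ (-‿cong (sym (*-assoc _ _ _)))) r))

            E≈ : E ≈ E * ((1# - a * a * y * Q) * e₁ * ((1# - a * a * y * (q * Q)) * e₂))
            E≈ = sym (trans (*-congˡ (trans (*-cong (e-inverse (suc r)) (e-inverse (suc (suc r)))) (*-identityˡ 1#))) (*-identityʳ E))

            regroup : ∀ A B U E G h e₁ e₂ x₁ x₂ →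
              (1# + a * Q) * ((1# - a * a) * A) * (B * U) * (E * (x₁ * e₁ * (x₂ * e₂))) * (G * h) ≈
              (1# + a) * A * B * U * (E * e₁ * e₂) * (G * h) * ((1# + a * Q) * (1# - a) * x₁ * x₂)
            regroup A B U E G h e₁ e₂ x₁ x₂ = solve 12 (λ a Q A B U E G h e₁ e₂ x₁ x₂ →
              (:1 :+ a :* Q) :* ((:1 :- a :* a) :* A) :* (B :* U) :* (E :* (x₁ :* e₁ :* (x₂ :* e₂))) :* (G :* h) :=
              (:1 :+ a) :* A :* B :* U :* (E :* e₁ :* e₂) :* (G :* h) :* ((:1 :+ a :* Q) :* (:1 :- a) :* x₁ :* x₂))
              refl a Q A B U E G h e₁ e₂ x₁ x₂

          -- Both sides are (a²q;q)ᵣ₊₂, split at its first factor and at its last two.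
          A-factor : (1# - a * a * q) * ∏ (λ j → 1# - a * q * (a * q) * q ^ j) (suc r) ≈
            A * (1# - a * a * Q) * (1# - a * a * q * Q)
          A-factor = begin
            (1# - a * a * q) * ∏ (λ j → 1# - a * q * (a * q) * q ^ j) (suc r)
              ≈⟨ *-cong (+-congˡ (-‿cong (sym (*-identityʳ _)))) (∏-cong (λ j → +-congˡ (-‿cong
                   (solve 3 (λ a q p → a :* q :* (a :* q) :* p :=
                        a :* a :* q :* (q :* p)) refl a q (q ^ j)))) (suc r)) ⟩
            (1# - a * a * q * 1#) * ∏ (λ j → 1# - a * a * q * q ^ suc j) (suc r)
              ≈⟨ ∏-head (λ j → 1# - a * a * q * q ^ j) (suc r) ⟨
            A * (1# - a * a * q * q ^ r) * (1# - a * a * q * Q)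
              ≈⟨ *-congʳ (*-congˡ (+-congˡ (-‿cong (*-assoc _ _ _)))) ⟩
            A * (1# - a * a * Q) * (1# - a * a * q * Q) ∎

          U-factor : ∏ (λ j → - (a * q * y * q ^ j)) (suc r) ≈ Q * U
          U-factor = trans (∏-cong (λ j →
              solve 4 (λ a q y p → :- (a :* q :* y :* p) :=
                   q :* :- (a :* y :* p)) refl a q y (q ^ j)) (suc r))
                           (∏-scale q _ (suc r))

          E-factor : e 0 * e 1 * ∏ (shift e) (suc r) ≈ E * e₁ * e₂
          E-factor = sym (trans (∏-head e (suc (suc r))) (trans (*-congˡ (∏-head (e ∘ suc) (suc r))) (sym (*-assoc _ _ _))))

          W-factor : factor a e * summand (a * q) (shift e) (suc r) ≈
            W * ((1# - a * y) * (1# + a * q * Q) * (1# - a * a * Q) * (1# - a * a * q * Q) * Q)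
          W-factor = begin
            factor a e * summand (a * q) (shift e) (suc r)
              ≈⟨ solve 12 (λ a q Q y A B U E G h e₀ e₁ →
                   (:1 :+ a) :* (:1 :- a :* a :* q) :* (:1 :- a :* y) :* (e₀ :* e₁) :* ((:1 :+ a :* q :* Q) :* A :* (B :* U) :* E :* (G :* h)) :=
                   (:1 :+ a) :* (:1 :- a :* y) :* (:1 :+ a :* q :* Q) :* ((:1 :- a :* a :* q) :* A) :* (B :* U) :* (e₀ :* e₁ :* E) :* (G :* h))
                   refl a q Q y (∏ (λ j → 1# - a * q * (a * q) * q ^ j) (suc r)) B (∏ (λ j → - (a * q * y * q ^ j)) (suc r))
                   (∏ (shift e) (suc r)) G (g r) (e 0) (e 1) ⟩
            (1# + a) * (1# - a * y) * (1# + a * q * Q) * ((1# - a * a * q) * ∏ (λ j → 1# - a * q * (a * q) * q ^ j) (suc r))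
              * (B * ∏ (λ j → - (a * q * y * q ^ j)) (suc r)) * (e 0 * e 1 * ∏ (shift e) (suc r)) * (G * g r)
              ≈⟨ *-congʳ (*-cong (*-cong (*-congˡ A-factor) (*-congˡ U-factor)) E-factor) ⟩
            (1# + a) * (1# - a * y) * (1# + a * q * Q) * (A * (1# - a * a * Q) * (1# - a * a * q * Q))
              * (B * (Q * U)) * (E * e₁ * e₂) * (G * g r)
              ≈⟨ solve 11 (λ a Q A B U E G x₁ x₂ x₃ x₄ →
                   (:1 :+ a) :* x₁ :* x₂ :* (A :* x₃ :* x₄) :* (B :* (Q :* U)) :* E :* G :=
                   (:1 :+ a) :* A :* B :* U :* E :* G :* (x₁ :* x₂ :* x₃ :* x₄ :* Q))
                   refl a Q A B U (E * e₁ * e₂) (G * g r) (1# - a * y) (1# + a * q * Q) (1# - a * a * Q) (1# - a * a * q * Q) ⟩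
            W * ((1# - a * y) * (1# + a * q * Q) * (1# - a * a * Q) * (1# - a * a * q * Q) * Q) ∎

          W-remainder : remainder a e r ≈ W * ((1# - Q) * (1# - a * a * y * (q * Q)) * certificate a Q)
          W-remainder = begin
            (1# + a) * A * (B * U) * certificate a Q * (E * e₁) * G
              ≈⟨ *-cong (*-congˡ (trans (sym (*-identityʳ _)) (*-congˡ (sym (e-inverse (suc (suc r)))))))
                        (trans (sym (*-identityʳ G)) (*-congˡ (sym (g-inverse r)))) ⟩
            (1# + a) * A * (B * U) * certificate a Q * (E * e₁ * ((1# - a * a * y * (q * Q)) * e₂)) * (G * ((1# - Q) * g r))
              ≈⟨ solve 11 (λ a A B U E G h e x₁ x₂ x₃ →
                   (:1 :+ a) :* A :* (B :* U) :* x₁ :* (E :* (x₂ :* e)) :* (G :* (x₃ :* h)) :=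
                   (:1 :+ a) :* A :* B :* U :* (E :* e) :* (G :* h) :* (x₃ :* x₂ :* x₁))
                   refl a A B U (E * e₁) G (g r) e₂ (certificate a Q) (1# - a * a * y * (q * Q)) (1# - Q) ⟩
            W * ((1# - Q) * (1# - a * a * y * (q * Q)) * certificate a Q) ∎

          W-remainder-suc : remainder a e (suc r) ≈
            W * ((1# - a * a * Q) * (1# - b * Q) * - (a * y * Q) * certificate a (q * Q))
          W-remainder-suc = begin
            (1# + a) * (A * (1# - a * a * q * q ^ r)) * (B * (1# - b * Q) * (U * - (a * y * Q)))
              * certificate a (q * Q) * (E * e₁ * e₂) * (G * g r)
              ≈⟨ *-congʳ (*-congʳ (*-congʳ (*-congʳ (*-congˡ (*-congˡ (+-congˡ (-‿cong (*-assoc _ _ _)))))))) ⟩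
            (1# + a) * (A * (1# - a * a * Q)) * (B * (1# - b * Q) * (U * - (a * y * Q)))
              * certificate a (q * Q) * (E * e₁ * e₂) * (G * g r)
              ≈⟨ solve 10 (λ a A B U E G x₁ x₂ x₃ x₄ →
                   (:1 :+ a) :* (A :* x₁) :* (B :* x₂ :* (U :* x₃)) :* x₄ :* E :* G :=
                   (:1 :+ a) :* A :* B :* U :* E :* G :* (x₁ :* x₂ :* x₃ :* x₄))
                   refl a A B U (E * e₁ * e₂) (G * g r) (1# - a * a * Q) (1# - b * Q) (- (a * y * Q)) (certificate a (q * Q)) ⟩
            W * ((1# - a * a * Q) * (1# - b * Q) * - (a * y * Q) * certificate a (q * Q)) ∎

        summand-suc : remainder a e r + summand a e (suc r) ≈
          factor a e * summand (a * q) (shift e) (suc r) + remainder a e (suc r)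
        summand-suc = begin
          remainder a e r + summand a e (suc r)
            ≈⟨ +-cong W-remainder (trans W-summand (*-congˡ (certificate-identity a Q))) ⟩
          W * k₄ + W * (k₂ + (k₃ - k₄))
            ≈⟨ solve 4 (λ W k₂ k₃ k₄ → W :* k₄ :+ W :* (k₂ :+ (k₃ :- k₄)) :=
                 W :* k₂ :+ W :* k₃) refl W k₂ k₃ k₄ ⟩
          W * k₂ + W * k₃
            ≈⟨ +-cong W-factor W-remainder-suc ⟨
          factor a e * summand (a * q) (shift e) (suc r) + remainder a e (suc r) ∎
          where
          k₂ k₃ k₄ : Carrier
          k₂ = (1# - a * y) * (1# + a * q * Q) * (1# - a * a * Q) * (1# - a * a * q * Q) * Q
          k₃ = (1# - a * a * Q) * (1# - b * Q) * - (a * y * Q) * certificate a (q * Q)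
          k₄ = (1# - Q) * (1# - a * a * y * (q * Q)) * certificate a Q

      ∑-recurrence : ∀ n → ∑ (summand a e) (suc n) ≈
        factor a e * ∑ (summand (a * q) (shift e)) (suc n) + remainder a e n
      ∑-recurrence zero = begin
        0# + summand a e 0
          ≈⟨ trans (+-identityˡ _) summand₀ ⟩
        factor a e * summand (a * q) (shift e) 0 + remainder a e 0
          ≈⟨ +-congʳ (*-congˡ (+-identityˡ _)) ⟨
        factor a e * (0# + summand (a * q) (shift e) 0) + remainder a e 0 ∎
      ∑-recurrence (suc n) = begin
        ∑ (summand a e) (suc n) + summand a e (suc n)
          ≈⟨ +-congʳ (∑-recurrence n) ⟩
        f * S + remainder a e n + summand a e (suc n)
          ≈⟨ trans (+-assoc _ _ _) (+-congˡ (summand-suc n)) ⟩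
        f * S + (f * t + remainder a e (suc n))
          ≈⟨ trans (sym (+-assoc _ _ _)) (+-congʳ (sym (distribˡ f S t))) ⟩
        f * (S + t) + remainder a e (suc n) ∎
        where
        f = factor a e
        S = ∑ (summand (a * q) (shift e)) (suc n)
        t = summand (a * q) (shift e) (suc n)

  module Iteration (a : Carrier) (e : ℕ → Carrier) where

    -- Recursive rather than a qᵏ, so that one step of the recurrence applies definitionally.
    aₖ : ℕ → Carrier
    aₖ zero    = a
    aₖ (suc k) = aₖ k * q

    eₖ : ℕ → ℕ → Carrier
    eₖ zero    = e
    eₖ (suc k) = shift (eₖ k)

    factorₖ : ℕ → Carrier
    factorₖ k = factor (aₖ k) (eₖ k)

    module _ (by≈q : b * y ≈ q) (g-inverse : ∀ j → (1# - q * q ^ j) * g j ≈ 1#)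
             (e-inverse : ∀ j → (1# - a * a * y * q ^ j) * e j ≈ 1#) where

      eₖ-inverse : ∀ k j → (1# - aₖ k * aₖ k * y * q ^ j) * eₖ k j ≈ 1#
      eₖ-inverse zero    j = e-inverse j
      eₖ-inverse (suc k) j = trans
        (*-congʳ (+-congˡ (-‿cong
          (solve 4 (λ a q y p → a :* q :* (a :* q) :* y :* p :=
               a :* a :* y :* (q :* (q :* p))) refl (aₖ k) q y (q ^ j)))))
        (eₖ-inverse k (suc (suc j)))

      ∑-iterated : ∀ n k → ∑ (summand a e) (suc n) ≈
        ∏ factorₖ k * ∑ (summand (aₖ k) (eₖ k)) (suc n) + ∑ (λ k → ∏ factorₖ k * remainder (aₖ k) (eₖ k) n) k
      ∑-iterated n zero    = sym (trans (+-identityʳ _) (*-identityˡ _))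
      ∑-iterated n (suc k) = begin
        ∑ (summand a e) (suc n)
          ≈⟨ ∑-iterated n k ⟩
        ∏ factorₖ k * ∑ (summand (aₖ k) (eₖ k)) (suc n) + T
          ≈⟨ +-congʳ (*-congˡ (∑-recurrence by≈q g-inverse (aₖ k) (eₖ k) (eₖ-inverse k) n)) ⟩
        ∏ factorₖ k * (factorₖ k * S + remainder (aₖ k) (eₖ k) n) + T
          ≈⟨ solve 5 (λ F f S r T → F :* (f :* S :+ r) :+ T :=
               F :* f :* S :+ (T :+ F :* r))
               refl (∏ factorₖ k) (factorₖ k) S (remainder (aₖ k) (eₖ k) n) T ⟩
        ∏ factorₖ k * factorₖ k * S + (T + ∏ factorₖ k * remainder (aₖ k) (eₖ k) n) ∎
        where
        S = ∑ (summand (aₖ (suc k)) (eₖ (suc k))) (suc n)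
        T = ∑ (λ k → ∏ factorₖ k * remainder (aₖ k) (eₖ k) n) k

-- Uniform estimates for the iterated recurrence and passage to the limit.

module QSeries {c ℓ₁ ℓ₂} (ℝ : RealField c ℓ₁ ℓ₂)
  {a ℓ ℓ#} (F : HeytingField a ℓ ℓ#) (∣F∣ : Normed.CompleteNorm ℝ F) {ρ : RealField.Carrier ℝ}
  (0≤ρ : RealProperties._≤_ ℝ (RealField.0# ℝ) ρ) (ρ<1 : RealField._<_ ℝ ρ (RealField.1# ℝ))
  {q : HeytingField.Carrier F} (q≼ρ : Normed.CompleteNorm._≼_ ∣F∣ q ρ) where

  open HeytingField F
  open Normed.CompleteNorm ∣F∣
  open HeytingFieldOperations F using (_^_)
  open InvertibleElements F using (commutativeRing)
  open FiniteOperations commutativeRing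
  open Asymptotics ℝ F ∣F∣ 0≤ρ ρ<1
  open IntegerRingSolver commutativeRing
  open import Relation.Binary.Reasoning.Setoid setoid
  private
    variable
      I : Set
      s t : I → Carrier
      d : I → ℕ

  O-*ˡ : Bounded s → O d t → O d (λ i → s i * t i)
  O-*ˡ = O-*

  O-*ʳ : O d s → Bounded t → O d (λ i → s i * t i)
  O-*ʳ s t = O-weaken (λ _ → ℕ.≤-reflexive (≡.sym (ℕ.+-identityʳ _))) (O-* s t)

  pochhammer : Carrier → Carrier → ℕ → Carrier
  pochhammer x p = ∏ (λ j → 1# - x * p ^ j)

  [q²]^j-O : O id ((q ^ 2) ^_)
  [q²]^j-O = O-weaken (λ j → ℕ.m≤m+n j j) (O-resp double (O-* (O-^ q≼ρ) (O-^ q≼ρ)))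
    where
    double : ∀ j → q ^ j * q ^ j ≈ (q ^ 2) ^ j
    double zero    = *-identityˡ 1#
    double (suc j) = trans
      (solve 2 (λ q p → q :* p :* (q :* p) := q :* (q :* :1) :* (p :* p)) refl q (q ^ j))
      (*-congˡ (double j))

  pochhammer-converges : ∀ x → ∃[ P ] pochhammer x q ⇝ P
  pochhammer-converges x = ∏-converges (O-neg (O-*ˡ (O-const x) (O-^ q≼ρ)))

  pochhammer²-converges : ∀ x → ∃[ P ] pochhammer x (q ^ 2) ⇝ P
  pochhammer²-converges x = ∏-converges (O-neg (O-*ˡ (O-const x) [q²]^j-O))

  q^-O : O {I = ℕ × ℕ} proj₂ (λ (_ , j) → q ^ j)
  q^-O = O-∘ proj₂ (O-^ q≼ρ)

  pochhammer-Bounded : {x : ℕ → Carrier} → Bounded x → Bounded {I = ℕ × ℕ} (λ (k , n) → pochhammer (x k) q n)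
  pochhammer-Bounded {x} x-Bounded =
    O-∏-1+ {s = λ k j → - (x k * q ^ j)} (O-neg (O-*ˡ (O-∘ proj₁ x-Bounded) q^-O))

  -- Writing 1/(1 - x) as 1 + x/(1 - x) turns products of inverses into products of the form ∏(1 +
  -- sⱼ).
  inverse≈ : ∀ {x u} → (1# - x) * u ≈ 1# → 1# + x * u ≈ u
  inverse≈ {x} {u} eq = trans (+-congʳ (sym eq))
    (solve 2 (λ x u → (:1 :- x) :* u :+ x :* u := u) refl x u)

  inverseFactor-O : ∀ {x} {u : ℕ → Carrier} → (∀ j → (1# - x * q ^ j) * u j ≈ 1#) → O id (λ j → x * q ^ j * u j)
  inverseFactor-O {x} xu≈1 = O-*ʳ x*q^ (inverse-Bounded x*q^ xu≈1)
    where
    x*q^ : O id (λ j → x * q ^ j)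
    x*q^ = O-*ˡ (O-const x) (O-^ q≼ρ)

  ∏-inverse-converges : ∀ {x} {u : ℕ → Carrier} → (∀ j → (1# - x * q ^ j) * u j ≈ 1#) → ∃[ P ] ∏ u ⇝ P
  ∏-inverse-converges {x} {u} xu≈1 = proj₁ limit , ⇝-resp (∏-cong (λ j → inverse≈ (xu≈1 j))) (proj₂ limit)
    where
    limit : ∃[ P ] ∏ (λ j → 1# + x * q ^ j * u j) ⇝ P
    limit = ∏-converges (inverseFactor-O xu≈1)

  module Summation (a b y : Carrier) (e g : ℕ → Carrier) (by≈q : b * y ≈ q)
    (e-inverse : ∀ j → (1# - a * a * y * q ^ j) * e j ≈ 1#)
    (g-inverse : ∀ j → (1# - q * q ^ j) * g j ≈ 1#) where

    open Recurrence commutativeRing b q y g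
    open Iteration a e

    aₖ≈ : ∀ k → a * q ^ k ≈ aₖ k
    aₖ≈ zero    = *-identityʳ a
    aₖ≈ (suc k) = trans (solve 3 (λ a q p → a :* (q :* p) :=
         a :* p :* q) refl a q (q ^ k)) (*-congʳ (aₖ≈ k))

    eₖ≡ : ∀ k j → e (k ℕ.+ k ℕ.+ j) ≡.≡ eₖ k j
    eₖ≡ zero    j = ≡.refl
    eₖ≡ (suc k) j = ≡.trans (≡.cong e index) (eₖ≡ k (suc (suc j)))
      where
      index : suc k ℕ.+ suc k ℕ.+ j ≡.≡ k ℕ.+ k ℕ.+ suc (suc j)
      index = ≡.trans (≡.cong (λ m → suc (m ℕ.+ j)) (ℕ.+-suc k k))
        (≡.sym (≡.trans (ℕ.+-suc (k ℕ.+ k) (suc j)) (≡.cong suc (ℕ.+-suc (k ℕ.+ k) j))))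

    aₖ-O : O id aₖ
    aₖ-O = O-resp aₖ≈ (O-*ˡ (O-const a) (O-^ q≼ρ))

    aₖ-Bounded : Bounded aₖ
    aₖ-Bounded = O⇒Bounded aₖ-O

    aₖaₖ-Bounded : Bounded (λ k → aₖ k * aₖ k)
    aₖaₖ-Bounded = O-*ˡ aₖ-Bounded aₖ-Bounded

    ∏eₖ-Bounded : Bounded {I = ℕ × ℕ} (λ (k , n) → ∏ (eₖ k) n)
    ∏eₖ-Bounded = O-resp (λ (k , n) → ∏-cong (λ j → inverse≈ (eₖ-inverse by≈q g-inverse e-inverse k j)) n)
      (O-∏-1+ {s = λ k j → aₖ k * aₖ k * y * q ^ j * eₖ k j}
        (O-*ʳ (O-*ˡ (O-∘ proj₁ (O-*ˡ aₖaₖ-Bounded (O-const y))) q^-O) eₖ-Bounded))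
      where
      -- Uniformity in k is free: all these values belong to the single bounded sequence e, at index
      -- 2k + j.
      eₖ-Bounded : Bounded {I = ℕ × ℕ} (λ (k , j) → eₖ k j)
      eₖ-Bounded = O-resp (λ (k , j) → reflexive (eₖ≡ k j)) (O-∘ {J = ℕ × ℕ} (λ (k , j) → k ℕ.+ k ℕ.+ j)
        (inverse-Bounded (O-*ˡ (O-const (a * a * y)) (O-^ q≼ρ)) e-inverse))

    ∏g-Bounded : Bounded {I = ℕ × ℕ} (λ (_ , n) → ∏ g n)
    ∏g-Bounded = O-resp (λ (_ , n) → ∏-cong (λ j → inverse≈ (g-inverse j)) n)
      (O-∏-1+ {s = λ _ j → q * q ^ j * g j} (O-∘ proj₂ (inverseFactor-O g-inverse)))

    double-index : ℕ × ℕ → ℕ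
    double-index (k , n) = k ℕ.+ n

    next : ℕ × ℕ → ℕ × ℕ
    next (k , n) = k , suc n

    -- The last factor -aₖ y qⁿ alone yields the decay ρᵏ⁺ⁿ; all the others are merely bounded.
    numerator-O : O double-index (λ (k , n) → numerator (aₖ k) (suc n))
    numerator-O = O-*ˡ (O-∘ next (pochhammer-Bounded {x = λ _ → b} (O-const b))) (O-*ˡ
      (O-∏ {s = λ k j → - (aₖ k * y * q ^ j)} (O-weaken (λ (k , j) → ℕ.m≤n+m j k) factor-O))
      factor-O)
      where
      factor-O : O double-index (λ (k , j) → - (aₖ k * y * q ^ j))
      factor-O = O-neg (O-* (O-∘ proj₁ (O-*ʳ aₖ-O (O-const y))) q^-O)

    remainder-O : O double-index (λ (k , n) → remainder (aₖ k) (eₖ k) n)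
    remainder-O = O-*ʳ (O-*ʳ (O-*ʳ (O-*ˡ (O-*ˡ
      (O-∘ proj₁ (O-+ (O-const 1#) aₖ-Bounded))
      (pochhammer-Bounded (O-*ˡ aₖaₖ-Bounded (O-const q))))
      numerator-O)
      (O-- (O-*ˡ (O-*ˡ (O-∘ proj₁ aₖaₖ-Bounded) (O-- (O-const 1#) (O-*ˡ (O-∘ proj₁ aₖ-Bounded) (O-const y))))
                 (O⇒Bounded (O-∘ next q^-O)))
           (O-- (O-const 1#) (O-∘ proj₁ aₖ-Bounded))))
      (O-∘ (next ∘ next) ∏eₖ-Bounded))
      ∏g-Bounded

    summand-O : O double-index (λ (k , n) → summand (aₖ k) (eₖ k) (suc n))
    summand-O = O-*ʳ (O-*ʳ (O-*ˡ (O-*ˡ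
      (O-+ (O-const 1#) (O-*ˡ (O-∘ proj₁ aₖ-Bounded) (O⇒Bounded (O-∘ next q^-O))))
      (O-∘ next (pochhammer-Bounded aₖaₖ-Bounded)))
      numerator-O)
      (O-∘ next ∏eₖ-Bounded))
      (O-∘ next ∏g-Bounded)

    -- The zeroth summand is 1 + aₖ, and the later ones are O(ρᵏ⁺ⁿ), which sum over n to O(ρᵏ).
    ∑-summand-O : O {I = ℕ × ℕ} proj₁ (λ (k , n) → ∑ (summand (aₖ k) (eₖ k)) (suc n) - 1#)
    ∑-summand-O = O-resp (λ (k , n) → begin
      aₖ k + ∑ (summand (aₖ k) (eₖ k) ∘ suc) n
        ≈⟨ solve 2 (λ a S → a :+ S :=
             (:1 :+ a :* :1) :* :1 :* (:1 :* :1) :* :1 :* :1 :+ S :- :1) refl (aₖ k) _ ⟩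
      summand (aₖ k) (eₖ k) 0 + ∑ (summand (aₖ k) (eₖ k) ∘ suc) n - 1#
        ≈⟨ +-congʳ (∑-head (summand (aₖ k) (eₖ k)) n) ⟨
      ∑ (summand (aₖ k) (eₖ k)) (suc n) - 1# ∎)
      (O-+ (O-∘ proj₁ aₖ-O) (O-∑ {e = id} {s = λ k → summand (aₖ k) (eₖ k) ∘ suc} summand-O))

    -- Each step supplies two inverses, hence the length n + n. The base q² arises from aₖ² q = a² q
    -- (q²)ᵏ.
    ∏-factorₖ : ∀ {β} → q * β ≈ y → ∀ n →
      pochhammer (- a) q n * pochhammer (a ^ 2 * q) (q ^ 2) n * pochhammer (a * q * β) q n * ∏ e (n ℕ.+ n) ≈ ∏ factorₖ n
    ∏-factorₖ {β} qβ≈y zero = solve 0 (:1 :* :1 :* :1 :* :1 := :1) refl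
    ∏-factorₖ {β} qβ≈y (suc n) = begin
      p₁ * (1# - - a * Q) * (p₂ * (1# - a ^ 2 * q * (q ^ 2) ^ n)) * (p₃ * (1# - a * q * β * Q)) * ∏ e (suc (n ℕ.+ suc n))
        ≈⟨ *-cong (*-cong (*-cong (*-congˡ first) (*-congˡ second)) (*-congˡ third)) (reflexive (≡.cong (∏ e ∘ suc) (ℕ.+-suc n n))) ⟩
      p₁ * (1# + aₖ n) * (p₂ * (1# - aₖ n * aₖ n * q)) * (p₃ * (1# - aₖ n * y)) * (p₄ * e (n ℕ.+ n) * e (suc (n ℕ.+ n)))
        ≈⟨ solve 9 (λ p₁ p₂ p₃ p₄ x₁ x₂ x₃ x₄ x₅ → p₁ :* x₁ :* (p₂ :* x₂) :* (p₃ :* x₃) :* (p₄ :* x₄ :* x₅) :=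
             p₁ :* p₂ :* p₃ :* p₄ :* (x₁ :* x₂ :* x₃ :* (x₄ :* x₅))) refl p₁ p₂ p₃ p₄
             (1# + aₖ n) (1# - aₖ n * aₖ n * q) (1# - aₖ n * y) (e (n ℕ.+ n)) (e (suc (n ℕ.+ n))) ⟩
      p₁ * p₂ * p₃ * p₄ * ((1# + aₖ n) * (1# - aₖ n * aₖ n * q) * (1# - aₖ n * y) * (e (n ℕ.+ n) * e (suc (n ℕ.+ n))))
        ≈⟨ *-cong (∏-factorₖ qβ≈y n) (*-congˡ (*-cong (index 0 (ℕ.+-identityʳ _)) (index 1 (ℕ.+-comm _ 1)))) ⟩
      ∏ factorₖ n * factorₖ n ∎
      where
      Q = q ^ n
      p₁ = pochhammer (- a) q n
      p₂ = pochhammer (a ^ 2 * q) (q ^ 2) n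
      p₃ = pochhammer (a * q * β) q n
      p₄ = ∏ e (n ℕ.+ n)

      index : ∀ j {m} → n ℕ.+ n ℕ.+ j ≡.≡ m → e m ≈ eₖ n j
      index j ≡.refl = reflexive (eₖ≡ n j)

      square : ∀ j → a * q ^ j * (a * q ^ j) ≈ a ^ 2 * (q ^ 2) ^ j
      square zero    = solve 1 (λ a → a :* :1 :* (a :* :1) := a :* (a :* :1) :* :1) refl a
      square (suc j) = begin
        a * (q * q ^ j) * (a * (q * q ^ j))
          ≈⟨ solve 3 (λ a q p → a :* (q :* p) :* (a :* (q :* p)) :=
               q :* (q :* :1) :* (a :* p :* (a :* p))) refl a q (q ^ j) ⟩
        q ^ 2 * (a * q ^ j * (a * q ^ j))
          ≈⟨ *-congˡ (square j) ⟩
        q ^ 2 * (a ^ 2 * (q ^ 2) ^ j)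
          ≈⟨ solve 3 (λ a q p → q :* (a :* p) := a :* (q :* p)) refl (a ^ 2) (q ^ 2) ((q ^ 2) ^ j) ⟩
        a ^ 2 * (q ^ 2) ^ suc j ∎

      first : 1# - - a * Q ≈ 1# + aₖ n
      first = trans (solve 2 (λ a p → :1 :- :- a :* p := :1 :+ a :* p) refl a Q) (+-congˡ (aₖ≈ n))

      second : 1# - a ^ 2 * q * (q ^ 2) ^ n ≈ 1# - aₖ n * aₖ n * q
      second = +-congˡ (-‿cong (trans
        (solve 3 (λ a q p → a :* q :* p := a :* p :* q) refl (a ^ 2) q ((q ^ 2) ^ n))
        (*-congʳ (trans (sym (square n)) (*-cong (aₖ≈ n) (aₖ≈ n))))))

      third : 1# - a * q * β * Q ≈ 1# - aₖ n * y
      third = +-congˡ (-‿cong (trans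
        (solve 4 (λ a q β p → a :* q :* β :* p := a :* p :* (q :* β)) refl a q β Q)
        (*-cong (aₖ≈ n) qβ≈y)))

    -- The diagonal k = n of `∑-iterated`. With F the product of factors, S the shifted partial sum,
    -- T the accumulated remainders and L the limit, the error is F (S - 1) + T + (F - L), and each
    -- of the three parts is O(ρⁿ).
    summation : ∀ {β P₁ P₂ P₃ P₄⁻¹} → q * β ≈ y →
      pochhammer (- a) q ⇝ P₁ → pochhammer (a ^ 2 * q) (q ^ 2) ⇝ P₂ → pochhammer (a * q * β) q ⇝ P₃ → ∏ e ⇝ P₄⁻¹ →
      ∑ (summand a e) ∘ suc ⇝ P₁ * P₂ * P₃ * P₄⁻¹
    summation {β} {P₁} {P₂} {P₃} {P₄⁻¹} qβ≈y ⇝P₁ ⇝P₂ ⇝P₃ ⇝P₄⁻¹ = O-resp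
      (λ n → trans
        (solve 4 (λ F S T L → F :* (S :- :1) :+ T :+ (F :- L) := F :* S :+ T :- L) refl (∏ factorₖ n) _ _ _)
        (+-congʳ (sym (∑-iterated by≈q g-inverse e-inverse n n))))
      (O-+ (O-+
        (O-*ˡ ∏factorₖ-Bounded (O-∘ (λ n → n , n) ∑-summand-O))
        (O-∘ (λ n → n , n) (O-∑ {e = id} {s = λ n k → ∏ factorₖ k * remainder (aₖ k) (eₖ k) n}
          (O-*ˡ (O-∘ proj₂ ∏factorₖ-Bounded)
            (O-weaken (λ (n , k) → ℕ.≤-reflexive (ℕ.+-comm n k)) (O-∘ (λ (n , k) → k , n) remainder-O))))))
        ∏factorₖ⇝)
      where
      ∏factorₖ⇝ : ∏ factorₖ ⇝ P₁ * P₂ * P₃ * P₄⁻¹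
      ∏factorₖ⇝ = ⇝-resp (∏-factorₖ qβ≈y)
        (⇝-* (⇝-* (⇝-* ⇝P₁ ⇝P₂) ⇝P₃) (O-weaken (λ n → ℕ.m≤m+n n n) (O-∘ (λ n → n ℕ.+ n) ⇝P₄⁻¹)))

      ∏factorₖ-Bounded : Bounded (∏ factorₖ)
      ∏factorₖ-Bounded = ⇝⇒Bounded ∏factorₖ⇝

-- Translation between the quotients of the theorem and products of inverses.

module HeytingFieldSeries {c ℓ₁ ℓ₂} (F : HeytingField c ℓ₁ ℓ₂) where
  open HeytingField F
  open HeytingFieldOperations F
  open InvertibleElements F
  open FiniteOperations commutativeRing
  open IntegerRingSolver commutativeRing
  open CommutativeRing commutativeRing using (semiring)
  open import Algebra.Properties.Semiring.Exp semiring using (^-homo-*)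
  open import Relation.Binary.Reasoning.Setoid setoid

  product≈∏ : ∀ f n → product {n} (λ j → f (toℕ j)) ≈ ∏ f n
  product≈∏ f zero    = refl
  product≈∏ f (suc n) = trans (*-congˡ (product≈∏ (f ∘ suc) n)) (sym (∏-head f n))

  partialSum≈∑ : ∀ f n → partialSum f n ≈ ∑ f n
  partialSum≈∑ f zero    = refl
  partialSum≈∑ f (suc n) = trans (+-congˡ (partialSum≈∑ (f ∘ suc) n)) (sym (∑-head f n))

  ÷≈* : ∀ {x y u} (y#0 : y # 0#) → y * u ≈ 1# → x ÷ y [ y#0 ] ≈ x * u
  ÷≈* y#0 yu≈1 = *-congˡ (inverse-unique (*-inverseʳ y#0) yu≈1)

  -- The numerator splits as 2(r + 1) + r(r + 1); the first part is even, so truncating division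
  -- distributes over the sum.
  triangular : ∀ r → (suc r ℕ.* suc (suc r)) ℕ./ 2 ≡.≡ suc r ℕ.+ (r ℕ.* suc r) ℕ./ 2
  triangular r = ≡.trans (≡.cong (ℕ._/ 2) (expand r))
    (≡.trans (ℕ.+-distrib-/-∣ˡ (r ℕ.* suc r) (ℕ.n∣m*n (suc r)))
      (≡.cong (ℕ._+ (r ℕ.* suc r) ℕ./ 2) (ℕ.m*n/n≡m (suc r) 2)))
    where
    expand : ∀ r → suc r ℕ.* suc (suc r) ≡.≡ suc r ℕ.* 2 ℕ.+ r ℕ.* suc r
    expand = solveℕ 1 (λ r → (con′ 1 ⊕ r) ⊗ (con′ 2 ⊕ r) ⊜ (con′ 1 ⊕ r) ⊗ con′ 2 ⊕ r ⊗ (con′ 1 ⊕ r)) ≡.refl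
      where open ℕ.+-*-Solver renaming (solve to solveℕ; _:*_ to _⊗_; _:+_ to _⊕_; _:=_ to _⊜_; con to con′)

  ∏-powers : ∀ q r → ∏ (λ j → q * q ^ j) r ≈ q ^ ((r ℕ.* suc r) ℕ./ 2)
  ∏-powers q zero    = refl
  ∏-powers q (suc r) = begin
    ∏ (λ j → q * q ^ j) r * q ^ suc r              ≈⟨ *-comm _ _ ⟩
    q ^ suc r * ∏ (λ j → q * q ^ j) r              ≈⟨ *-congˡ (∏-powers q r) ⟩
    q ^ suc r * q ^ ((r ℕ.* suc r) ℕ./ 2)          ≈⟨ ^-homo-* q (suc r) _ ⟨
    q ^ (suc r ℕ.+ (r ℕ.* suc r) ℕ./ 2)            ≡⟨ ≡.cong (q ^_) (triangular r) ⟨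
    q ^ ((suc r ℕ.* suc (suc r)) ℕ./ 2)            ∎

  pochhammer-inverse : ∀ x q {e : ℕ → Carrier} → (∀ j → (1# - x * q ^ j) * e j ≈ 1#) → ∀ n → [ x ⨟ q ] n * ∏ e n ≈ 1#
  pochhammer-inverse x q xe≈1 n = trans (*-congʳ (product≈∏ (λ j → 1# - x * q ^ j) n)) (∏-inverse xe≈1 n)

  -- The hypothesis inverts a²qʲ⁺¹ - b, whereas the denominator is 1 - a²qʲ⁺¹/b, its multiple by
  -- -1/b; hence the correction -b.
  denominatorInverse : ∀ {a b q β u j} → b * β ≈ 1# → (a ^ 2 * q ^ suc j - b) * u ≈ 1# →
    (1# - a ^ 2 * q * β * q ^ j) * - (b * u) ≈ 1#
  denominatorInverse {a} {b} {q} {β} {u} {j} bβ≈1 eq = begin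
    (1# - a ^ 2 * q * β * q ^ j) * - (b * u)
      ≈⟨ *-congʳ (+-congʳ (sym bβ≈1)) ⟩
    (b * β - a ^ 2 * q * β * q ^ j) * - (b * u)
      ≈⟨ solve 6 (λ a b q β u p → (b :* β :- a :* q :* β :* p) :* :- (b :* u) :=
           (a :* (q :* p) :- b) :* u :* (b :* β)) refl (a ^ 2) b q β u (q ^ j) ⟩
    (a ^ 2 * q ^ suc j - b) * u * (b * β)
      ≈⟨ trans (*-cong eq bβ≈1) (*-identityˡ 1#) ⟩
    1# ∎

  module _ {a b q β : Carrier} {g e : ℕ → Carrier} where
    open Recurrence commutativeRing b q (q * β) g using (summand)

    summand≈ : ∀ r {d} (d#0 : d # 0#) → d * (∏ e r * ∏ g r) ≈ 1# →
      summand a e r ≈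
      ((1# + a * q ^ r) * [ a ^ 2 ⨟ q ] r * [ b ⨟ q ] r * (- (a * β)) ^ r * q ^ ((r ℕ.* suc r) ℕ./ 2)) ÷ d [ d#0 ]
    summand≈ r {d} d#0 inverse = begin
      (1# + a * q ^ r) * A * (B * U) * ∏ e r * ∏ g r
        ≈⟨ solve 6 (λ x A B U E G → x :* A :* (B :* U) :* E :* G :=
             x :* A :* B :* U :* (E :* G)) refl (1# + a * q ^ r) A B U (∏ e r) (∏ g r) ⟩
      (1# + a * q ^ r) * A * B * U * (∏ e r * ∏ g r)
        ≈⟨ *-congʳ (*-cong (*-cong (*-congˡ A≈) (sym (product≈∏ _ r))) U≈) ⟩
      (1# + a * q ^ r) * [ a ^ 2 ⨟ q ] r * [ b ⨟ q ] r * ((- (a * β)) ^ r * q ^ ((r ℕ.* suc r) ℕ./ 2)) * (∏ e r * ∏ g r)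
        ≈⟨ *-congʳ (*-assoc _ _ _) ⟨
      (1# + a * q ^ r) * [ a ^ 2 ⨟ q ] r * [ b ⨟ q ] r * (- (a * β)) ^ r * q ^ ((r ℕ.* suc r) ℕ./ 2) * (∏ e r * ∏ g r)
        ≈⟨ ÷≈* d#0 inverse ⟨
      ((1# + a * q ^ r) * [ a ^ 2 ⨟ q ] r * [ b ⨟ q ] r * (- (a * β)) ^ r * q ^ ((r ℕ.* suc r) ℕ./ 2)) ÷ d [ d#0 ] ∎
      where
      A = ∏ (λ j → 1# - a * a * q ^ j) r
      B = ∏ (λ j → 1# - b * q ^ j) r
      U = ∏ (λ j → - (a * (q * β) * q ^ j)) r

      A≈ : A ≈ [ a ^ 2 ⨟ q ] r
      A≈ = trans (∏-cong (λ j → +-congˡ (-‿cong (*-congʳ (*-congˡ (sym (*-identityʳ a)))))) r)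
                 (sym (product≈∏ (λ j → 1# - a ^ 2 * q ^ j) r))

      U≈ : U ≈ (- (a * β)) ^ r * q ^ ((r ℕ.* suc r) ℕ./ 2)
      U≈ = begin
        U
          ≈⟨ ∏-cong (λ j → solve 4 (λ a q β p → :- (a :* (q :* β) :* p) :=
               :- (a :* β) :* (q :* p)) refl a q β (q ^ j)) r ⟩
        ∏ (λ j → - (a * β) * (q * q ^ j)) r
          ≈⟨ ∏-scale (- (a * β)) (λ j → q * q ^ j) r ⟩
        (- (a * β)) ^ r * ∏ (λ j → q * q ^ j) r
          ≈⟨ *-congˡ (∏-powers q r) ⟩
        (- (a * β)) ^ r * q ^ ((r ℕ.* suc r) ℕ./ 2) ∎

-- The summation formula in a complete normed field.

module NormedFieldSeries {c ℓ₁ ℓ₂} (ℝ : RealField c ℓ₁ ℓ₂)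
  {a ℓ ℓ#} (F : HeytingField a ℓ ℓ#) (∣F∣ : Normed.CompleteNorm ℝ F) {ρ : RealField.Carrier ℝ}
  (0≤ρ : RealProperties._≤_ ℝ (RealField.0# ℝ) ρ) (ρ<1 : RealField._<_ ℝ ρ (RealField.1# ℝ))
  {q : HeytingField.Carrier F} (q≼ρ : Normed.CompleteNorm._≼_ ∣F∣ q ρ) where

  open Normed ℝ using (module ℝ)
  open HeytingField F
  open Normed.CompleteNorm ∣F∣
  open HeytingFieldOperations F
  open HeytingFieldSeries F
  open InvertibleElements F
  open FiniteOperations commutativeRing
  open Asymptotics ℝ F ∣F∣ 0≤ρ ρ<1
  open QSeries ℝ F ∣F∣ 0≤ρ ρ<1 q≼ρ
  open IntegerRingSolver commutativeRing
  open ℝ.Geometric 0≤ρ ρ<1 using (ρ^≤1)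
  open import Algebra.Apartness.Properties.HeytingCommutativeRing heytingCommutativeRing using (#-congʳ)
  open import Relation.Binary.Reasoning.Setoid setoid

  product⇝ : ∀ {x p P} → pochhammer x p ⇝ P → (λ n → [ x ⨟ p ] n) ⇝ P
  product⇝ {x} {p} = ⇝-resp (λ n → sym (product≈∏ (λ j → 1# - x * p ^ j) n))

  module _ {s u : ℕ → Carrier} {P : Carrier} (su≈1 : ∀ n → s n * u n ≈ 1#) (s⇝P : s ⇝ P) (u-Bounded : Bounded u) where

    -- Here u P = 1 - u (s - P), and boundedness of u makes the error at most ½ from some index on;
    -- so u P, and with it P, is apart from zero.
    limit#0 : P # 0#
    limit#0 = *#0⇒#0ʳ (#-congʳ uP≈ (1-z#0 (proj₂ small N ℕ.≤-refl) ½<1))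
      where
      small : ∃[ N ] ∀ n → N ℕ.≤ n → u n * (s n - P) ≼ ℝ.½
      small = O⇒eventually≼ (O-*ˡ u-Bounded s⇝P) ℝ.½ ℝ.0<½
      N : ℕ
      N = proj₁ small
      ½<1 : ℝ.½ ℝ.< ℝ.1#
      ½<1 = ℝ.<-respˡ-≈ (ℝ.*-identityˡ _) (ℝ.x*½<x ℝ.0<1)
      uP≈ : 1# - u N * (s N - P) ≈ u N * P
      uP≈ = trans (+-congʳ (sym (su≈1 N))) (solve 3 (λ s u P → s :* u :- u :* (s :- P) :=
           u :* P) refl (s N) (u N) P)

    -- The inverses inherit the rate of s, since u - 1/P = -(u/P)(s - P).
    inverse⇝ : ∀ {d} → P * d ≈ 1# → u ⇝ d
    inverse⇝ {d} Pd≈1 = O-resp (λ n → begin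
      - (u n * d) * (s n - P)          ≈⟨ solve 4 (λ u d s P → :- (u :* d) :* (s :- P) :=
           u :* (P :* d) :- s :* u :* d) refl (u n) d (s n) P ⟩
      u n * (P * d) - s n * u n * d    ≈⟨ +-cong (trans (*-congˡ Pd≈1) (*-identityʳ _)) (-‿cong (trans (*-congʳ (su≈1 n)) (*-identityˡ d))) ⟩
      u n - d                          ∎) (O-*ˡ (O-neg (O-*ˡ u-Bounded (O-const d))) s⇝P)

  module _ (a b : Carrier) (b#0 : b # 0#) (a²qᵐ#b : ∀ m → 1 ℕ.≤ m → a ^ 2 * q ^ m # b) where
    private
      β x : Carrier
      β = proj₁ (#⇒invertible b#0)
      x = a ^ 2 * q * β

    bβ≈1 : b * β ≈ 1#
    bβ≈1 = *-inverseʳ b#0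

    e g : ℕ → Carrier
    e j = - (b * proj₁ (#⇒invertible (a²qᵐ#b (suc j) (ℕ.s≤s ℕ.z≤n))))
    g j = proj₁ (#⇒invertible (1-q^#0 j))
      where
      1-q^#0 : ∀ j → 1# - q * q ^ j # 0#
      1-q^#0 j = 1-z#0 (O.bound (O-^ q≼ρ) (suc j)) (ℝ.≤-<-trans (ℝ.≤-trans (ℝ.≤-reflexive (ℝ.*-identityˡ _))
        (ℝ.≤-trans (ℝ.*-monoʳ-≤ 0≤ρ (ρ^≤1 j)) (ℝ.≤-reflexive (ℝ.*-identityʳ ρ)))) ρ<1)

    e-inverse : ∀ j → (1# - x * q ^ j) * e j ≈ 1#
    e-inverse j = denominatorInverse {a} {b} {q} {β} {j = j} bβ≈1 (proj₂ (proj₂ (#⇒invertible (a²qᵐ#b (suc j) (ℕ.s≤s ℕ.z≤n)))))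

    g-inverse : ∀ j → (1# - q * q ^ j) * g j ≈ 1#
    g-inverse j = *-inverseʳ _

    e-inverse′ : ∀ j → (1# - a * a * (q * β) * q ^ j) * e j ≈ 1#
    e-inverse′ j = trans (*-congʳ (+-congˡ (-‿cong
      (solve 4 (λ a q β p → a :* a :* (q :* β) :* p :=
           a :* (a :* :1) :* q :* β :* p) refl a q β (q ^ j))))) (e-inverse j)

    b[qβ]≈q : b * (q * β) ≈ q
    b[qβ]≈q = trans (solve 3 (λ b q β → b :* (q :* β) :=
         b :* β :* q) refl b q β) (trans (*-congʳ bβ≈1) (*-identityˡ q))

    denominator-inverse : ∀ r → [ x ⨟ q ] r * [ q ⨟ q ] r * (∏ e r * ∏ g r) ≈ 1#
    denominator-inverse r = trans
      (solve 4 (λ X Q E G → X :* Q :* (E :* G) :=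
           X :* E :* (Q :* G)) refl ([ x ⨟ q ] r) ([ q ⨟ q ] r) (∏ e r) (∏ g r))
      (trans (*-cong (pochhammer-inverse x q e-inverse r) (pochhammer-inverse q q g-inverse r)) (*-identityˡ 1#))

    -- The limit found here is anonymous and only shows boundedness; `inverse⇝` later identifies it
    -- as 1/P₄.
    ∏e-Bounded : Bounded (∏ e)
    ∏e-Bounded = ⇝⇒Bounded (proj₂ (∏-inverse-converges e-inverse))

    abstract
      -- Abstracting the notions of infinite product and sum leaves the field general: any notion
      -- implied by `⇝` will do. Sums are composed with `suc` because the recurrence concerns
      -- partial sums with at least one term.
      q-sum :
        ∀ {ℓ∞} {[_⨟_]∞≔_ : Carrier → Carrier → Carrier → Set ℓ∞} {HasSum : (ℕ → Carrier) → Carrier → Set ℓ∞} →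
        (∀ {x p P} → [ x ⨟ p ]_ ⇝ P → [ x ⨟ p ]∞≔ P) →
        (∀ {t S} → partialSum t ∘ suc ⇝ S → HasSum t S) →
        Σ[ denominator#0 ∈ (∀ r → [ a ^ 2 * q ÷ b [ b#0 ] ⨟ q ] r * [ q ⨟ q ] r # 0#) ]
        ∃[ P₁ ] ∃[ P₂ ] ∃[ P₃ ] ∃[ P₄ ]
          [ - a ⨟ q ]∞≔ P₁ ×
          [ a ^ 2 * q ⨟ q ^ 2 ]∞≔ P₂ ×
          [ a * q ÷ b [ b#0 ] ⨟ q ]∞≔ P₃ ×
          [ a ^ 2 * q ÷ b [ b#0 ] ⨟ q ]∞≔ P₄ ×
          Σ[ P₄#0 ∈ P₄ # 0# ]
            HasSum
              (λ r → ((1# + a * q ^ r) * [ a ^ 2 ⨟ q ] r * [ b ⨟ q ] r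
                        * (- (a ÷ b [ b#0 ])) ^ r * q ^ ((r ℕ.* suc r) ℕ./ 2))
                     ÷ ([ a ^ 2 * q ÷ b [ b#0 ] ⨟ q ] r * [ q ⨟ q ] r) [ denominator#0 r ])
              ((P₁ * P₂ * P₃) ÷ P₄ [ P₄#0 ])
      q-sum ⇝⇒∞ ⇝⇒HasSum = denominator#0 , P₁ , P₂ , P₃ , P₄ ,
        ⇝⇒∞ (product⇝ ⇝P₁) , ⇝⇒∞ (product⇝ ⇝P₂) , ⇝⇒∞ (product⇝ ⇝P₃) , ⇝⇒∞ (product⇝ ⇝P₄) , P₄#0 ,
        ⇝⇒HasSum (⇝-resp (λ n → trans
            (∑-cong (λ r → summand≈ r (denominator#0 r) (denominator-inverse r)) (suc n))
            (sym (partialSum≈∑ _ (suc n))))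
          (summation refl ⇝P₁ ⇝P₂ ⇝P₃ (inverse⇝ (∏-inverse e-inverse) ⇝P₄ ∏e-Bounded (*-inverseʳ P₄#0))))
        where
        open Summation a b (q * β) e g b[qβ]≈q e-inverse′ g-inverse

        denominator#0 : ∀ r → [ x ⨟ q ] r * [ q ⨟ q ] r # 0#
        denominator#0 r = inverse⇒#0 (denominator-inverse r)

        P₁ P₂ P₃ P₄ : Carrier
        P₁ = proj₁ (pochhammer-converges (- a))
        P₂ = proj₁ (pochhammer²-converges (a ^ 2 * q))
        P₃ = proj₁ (pochhammer-converges (a * q * β))
        P₄ = proj₁ (pochhammer-converges x)

        ⇝P₁ : pochhammer (- a) q ⇝ P₁
        ⇝P₁ = proj₂ (pochhammer-converges (- a))
        ⇝P₂ : pochhammer (a ^ 2 * q) (q ^ 2) ⇝ P₂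
        ⇝P₂ = proj₂ (pochhammer²-converges (a ^ 2 * q))
        ⇝P₃ : pochhammer (a * q * β) q ⇝ P₃
        ⇝P₃ = proj₂ (pochhammer-converges (a * q * β))
        ⇝P₄ : pochhammer x q ⇝ P₄
        ⇝P₄ = proj₂ (pochhammer-converges x)

        P₄#0 : P₄ # 0#
        P₄#0 = limit#0 (∏-inverse e-inverse) ⇝P₄ ∏e-Bounded

-- Specialisation to the complex numbers and to limits with ε.

theorem2p2 :
    ∀ {c ℓ₁ ℓ₂} (ℝ : RealField c ℓ₁ ℓ₂) →
    let open Complex ℝ
        open HeytingField complexField
        open HeytingFieldOperations complexField
    in
    (a b q : ℂ) →
    ∣ q ∣< RealField.1# ℝ →
    (b#0 : b # 0#) →
    (∀ (m : ℕ) → 1 ℕ.≤ m → a ^ 2 * q ^ m # b) →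
    Σ[ denominator#0 ∈ (∀ r → [ a ^ 2 * q ÷ b [ b#0 ] ⨟ q ] r * [ q ⨟ q ] r # 0#) ]
    ∃[ P₁ ] ∃[ P₂ ] ∃[ P₃ ] ∃[ P₄ ]
      [ - a ⨟ q ]∞≔ P₁ ×
      [ a ^ 2 * q ⨟ q ^ 2 ]∞≔ P₂ ×
      [ a * q ÷ b [ b#0 ] ⨟ q ]∞≔ P₃ ×
      [ a ^ 2 * q ÷ b [ b#0 ] ⨟ q ]∞≔ P₄ ×
      Σ[ P₄#0 ∈ P₄ # 0# ]
        HasSum
          (λ r → ((1# + a * q ^ r) * [ a ^ 2 ⨟ q ] r * [ b ⨟ q ] r
                    * (- (a ÷ b [ b#0 ])) ^ r * q ^ ((r ℕ.* suc r) ℕ./ 2))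
                 ÷ ([ a ^ 2 * q ÷ b [ b#0 ] ⨟ q ] r * [ q ⨟ q ] r) [ denominator#0 r ])
          ((P₁ * P₂ * P₃) ÷ P₄ [ P₄#0 ])
theorem2p2 ℝ a b q ∣q∣<1 b#0 a²qᵐ#b =
  q-sum a b b#0 a²qᵐ#b {[_⨟_]∞≔_ = [_⨟_]∞≔_} {HasSum = HasSum}
    (λ {x} {p} {P} → ⇝⇒∞ {x} {p} {P}) (λ {t} {S} → ⇝⇒HasSum {t} {S})
  where
  open Complex ℝ
  open HeytingFieldOperations complexField using ([_⨟_]_; partialSum)
  open ComplexProperties ℝ
  open RealField ℝ using (0#; 1#; _<_; _*_)
  open RealProperties ℝ using (_≤_; ½; 0<x*½; x*½<x)

  bound : ∃[ ρ ] ρ < 1# × q ≼ ρ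
  bound = ∣∣<1⇒≼ ∣q∣<1

  0≤ρ : 0# ≤ proj₁ bound
  0≤ρ = proj₁ (proj₂ (proj₂ bound))

  ρ<1 : proj₁ bound < 1#
  ρ<1 = proj₁ (proj₂ bound)

  open Asymptotics ℝ complexField complexNorm 0≤ρ ρ<1
  open NormedFieldSeries ℝ complexField complexNorm 0≤ρ ρ<1 (proj₂ (proj₂ bound))

  ⇝⇒⟶ : ∀ {s l} → s ⇝ l → s ⟶ l
  ⇝⇒⟶ s⇝l ε 0<ε = proj₁ small , λ n N≤n → ≼⇒∣∣< (proj₂ small n N≤n) (x*½<x 0<ε)
    where
    -- Half of ε turns the weak bound `≼` into the strict one that the limit demands.
    small = O⇒eventually≼ s⇝l (ε * ½) (0<x*½ 0<ε)

  ⟶-suc : ∀ {s l} → s ∘ suc ⟶ l → s ⟶ l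
  ⟶-suc s⟶l ε 0<ε = suc (proj₁ (s⟶l ε 0<ε)) , λ where
    (suc n) (ℕ.s≤s N≤n) → proj₂ (s⟶l ε 0<ε) n N≤n

  ⇝⇒∞ : ∀ {x p P} → [ x ⨟ p ]_ ⇝ P → [ x ⨟ p ]∞≔ P
  ⇝⇒∞ {x} {p} = ⇝⇒⟶ {[ x ⨟ p ]_}

  ⇝⇒HasSum : ∀ {t S} → partialSum t ∘ suc ⇝ S → HasSum t S
  ⇝⇒HasSum {t} sum⇝ = ⟶-suc {partialSum t} (⇝⇒⟶ {partialSum t ∘ suc} sum⇝)
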